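{- Let $k$ be a prime power, let $0 \le h \le 4$ be an integer, and let $n=k^2+k+1-h$. Then there exists a $C_4$-free subgraph of $K_{n,n}$ whose number of edges equals the right-hand side below for the given $h$, and consequently $$ z(k^2+k+1-h) \geq \begin{cases} k^3+2k^2+2k+1 & \text{for } h=0,\\ k^3+2k^2 & \text{for } h=1,\\ k^3+2k^2-2k & \text{for } h=2,\\ k^3+2k^2-4k+1 & \text{for } h=3,\\ k^3+2k^2-6k+2 & \text{for } h=4. \end{cases} $$
   Context: For a nonnegative integer $n$, $z(n)$ denotes the Zarankiewicz number $z(n,n;2,2)$: the maximum number of edges in a subgraph of the complete bipartite graph $K_{n,n}$ that does not contain $K_{2,2}=C_4$ (the 4-cycle) as a subgraph (not necessarily induced). Equivalently, $z(n)$ is the maximum number of 1's in an $n\times n$ 0-1 matrix with no $2\times 2$ submatrix (rows and columns not necessarily consecutive) consisting entirely of 1's. A prime power is a number $p^a$ with $p$ prime and $a\ge 1$. -}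

module Defs where

open import Data.Bool using (true; false)
open import Data.Empty using (⊥; ⊥-elim)
open import Data.Fin using (Fin)
open import Data.Fin.Patterns using (0F; 1F; 2F; 3F; 4F)
open import Data.Fin.Properties using (any?; _≟_)
open import Data.Fin.Subset as Subset using (Subset; _∈_; ∣_∣)
open import Data.Fin.Subset.Properties using (_∈?_; ∈⊤; ∉⊥; ∣⊥∣≡0)
open import Data.Integer using (ℤ; +_) renaming (_+_ to _+ᶻ_; _-_ to _-ᶻ_; _*_ to _*ᶻ_; _^_ to _^ᶻ_)
open import Data.List as List using (List; cartesianProductWith; filter)
open import Data.List.Extrema.Nat using (max; xs≤max; argmax-all)
open import Data.List.Membership.Propositional using () renaming (_∈_ to _∈ₗ_)
open import Data.List.Membership.Propositional.Properties using (∈-cartesianProductWith⁺; ∈-filter⁺; ∈-map⁺)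
open import Data.List.Relation.Unary.All as All using ()
open import Data.List.Relation.Unary.All.Properties using (all-filter; map⁺)
open import Data.List.Relation.Unary.Any using (here; there)
open import Data.Nat using (ℕ; zero; suc; _+_; _^_; _≤_)
open import Data.Nat.Primality using (Prime)
open import Data.Product using (∃; ∃₂; Σ; _×_; _,_)
open import Data.Sum using (_⊎_; inj₁; inj₂)
open import Data.Vec as Vec using (Vec; []; _∷_; lookup; replicate)
open import Data.Vec.Properties using (lookup-replicate)
open import Function.Base using (id; _∋_)
open import Function.Definitions using (Injective)
open import Relation.Binary.PropositionalEquality using (_≡_; _≢_; refl; cong₂; subst)
open import Relation.Nullary using (¬_; Dec; ¬?)
open import Relation.Nullary.Decidable using (_×-dec_; map′)

IsPrimePower : ℕ → Set
IsPrimePower k = ∃₂ λ p a → Prime p × 1 ≤ a × k ≡ p ^ a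

-- A spanning subgraph of K_{m,n}, given by its biadjacency matrix: row i is the
-- set of neighbours of the i-th left vertex.
BipGraph : ℕ → ℕ → Set
BipGraph m n = Vec (Subset n) m

Vertex : ℕ → ℕ → Set
Vertex m n = Fin m ⊎ Fin n

Adj : ∀ {m n} → BipGraph m n → Vertex m n → Vertex m n → Set
Adj G (inj₁ i) (inj₂ j) = j ∈ lookup G i
Adj G (inj₂ j) (inj₁ i) = j ∈ lookup G i
Adj G (inj₁ _) (inj₁ _) = ⊥
Adj G (inj₂ _) (inj₂ _) = ⊥

edges : ∀ {m n} → BipGraph m n → ℕ
edges G = Vec.sum (Vec.map ∣_∣ G)

K : ∀ m n → BipGraph m n
K m n = replicate m Subset.⊤

-- Not necessarily induced, and not required to respect the two sides.
ContainsSubgraph : ∀ {m n m′ n′} → BipGraph m n → BipGraph m′ n′ → Set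
ContainsSubgraph {m} {n} {m′} {n′} G H =
  Σ (Vertex m′ n′ → Vertex m n) λ f →
    Injective _≡_ _≡_ f × (∀ u v → Adj H u v → Adj G (f u) (f v))

C₄-Free : ∀ {m n} → BipGraph m n → Set
C₄-Free G = ¬ ContainsSubgraph G (K 2 2)

-- An all-ones 2 × 2 submatrix of the biadjacency matrix.
Rectangle : ∀ {m n} → BipGraph m n → Set
Rectangle {m} {n} G =
  ∃₂ λ (i i′ : Fin m) → ∃₂ λ (j j′ : Fin n) → i ≢ i′ × j ≢ j′ ×
    j ∈ lookup G i × j′ ∈ lookup G i × j ∈ lookup G i′ × j′ ∈ lookup G i′

rectangle⇒K₂₂ : ∀ {m n} (G : BipGraph m n) → Rectangle G → ContainsSubgraph G (K 2 2)
rectangle⇒K₂₂ {m} {n} G (i , i′ , j , j′ , i≢i′ , j≢j′ , ij , ij′ , i′j , i′j′) = f , inj , adj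
  where
  f : Vertex 2 2 → Vertex m n
  f (inj₁ 0F) = inj₁ i
  f (inj₁ 1F) = inj₁ i′
  f (inj₂ 0F) = inj₂ j
  f (inj₂ 1F) = inj₂ j′

  inj : Injective _≡_ _≡_ f
  inj {inj₁ 0F} {inj₁ 0F} _ = refl
  inj {inj₁ 1F} {inj₁ 1F} _ = refl
  inj {inj₂ 0F} {inj₂ 0F} _ = refl
  inj {inj₂ 1F} {inj₂ 1F} _ = refl
  inj {inj₁ 0F} {inj₁ 1F} refl = ⊥-elim (i≢i′ refl)
  inj {inj₁ 1F} {inj₁ 0F} refl = ⊥-elim (i≢i′ refl)
  inj {inj₂ 0F} {inj₂ 1F} refl = ⊥-elim (j≢j′ refl)
  inj {inj₂ 1F} {inj₂ 0F} refl = ⊥-elim (j≢j′ refl)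
  inj {inj₁ 0F} {inj₂ 0F} ()
  inj {inj₁ 0F} {inj₂ 1F} ()
  inj {inj₁ 1F} {inj₂ 0F} ()
  inj {inj₁ 1F} {inj₂ 1F} ()
  inj {inj₂ 0F} {inj₁ 0F} ()
  inj {inj₂ 0F} {inj₁ 1F} ()
  inj {inj₂ 1F} {inj₁ 0F} ()
  inj {inj₂ 1F} {inj₁ 1F} ()

  adj : ∀ u v → Adj (K 2 2) u v → Adj G (f u) (f v)
  adj (inj₁ 0F) (inj₂ 0F) _ = ij
  adj (inj₁ 0F) (inj₂ 1F) _ = ij′
  adj (inj₁ 1F) (inj₂ 0F) _ = i′j
  adj (inj₁ 1F) (inj₂ 1F) _ = i′j′
  adj (inj₂ 0F) (inj₁ 0F) _ = ij
  adj (inj₂ 0F) (inj₁ 1F) _ = i′j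
  adj (inj₂ 1F) (inj₁ 0F) _ = ij′
  adj (inj₂ 1F) (inj₁ 1F) _ = i′j′

cycle⇒rectangle : ∀ {m n} (G : BipGraph m n) (a b c d : Vertex m n) → a ≢ b → c ≢ d →
                  Adj G a c → Adj G a d → Adj G b c → Adj G b d → Rectangle G
cycle⇒rectangle G (inj₁ i) (inj₁ i′) (inj₂ j) (inj₂ j′) a≢b c≢d ac ad bc bd =
  i , i′ , j , j′ , (λ { refl → a≢b refl }) , (λ { refl → c≢d refl }) , ac , ad , bc , bd
cycle⇒rectangle G (inj₂ j) (inj₂ j′) (inj₁ i) (inj₁ i′) a≢b c≢d ac ad bc bd =
  i , i′ , j , j′ , (λ { refl → c≢d refl }) , (λ { refl → a≢b refl }) , ac , bc , ad , bd

K₂₂⇒rectangle : ∀ {m n} (G : BipGraph m n) → ContainsSubgraph G (K 2 2) → Rectangle G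
K₂₂⇒rectangle G (f , inj , adj) =
  cycle⇒rectangle G (f (inj₁ 0F)) (f (inj₁ 1F)) (f (inj₂ 0F)) (f (inj₂ 1F))
    (λ e → 0≢1 (inj e)) (λ e → 0≢1′ (inj e))
    (adj (inj₁ 0F) (inj₂ 0F) ∈⊤) (adj (inj₁ 0F) (inj₂ 1F) ∈⊤)
    (adj (inj₁ 1F) (inj₂ 0F) ∈⊤) (adj (inj₁ 1F) (inj₂ 1F) ∈⊤)
  where
  0≢1 : inj₁ 0F ≢ (Vertex 2 2 ∋ inj₁ 1F)
  0≢1 ()
  0≢1′ : inj₂ 0F ≢ (Vertex 2 2 ∋ inj₂ 1F)
  0≢1′ ()

rectangle? : ∀ {m n} (G : BipGraph m n) → Dec (Rectangle G)
rectangle? G =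
  any? λ i → any? λ i′ → any? λ j → any? λ j′ →
    ¬? (i ≟ i′) ×-dec ¬? (j ≟ j′) ×-dec
    j ∈? lookup G i ×-dec j′ ∈? lookup G i ×-dec j ∈? lookup G i′ ×-dec j′ ∈? lookup G i′

C₄-free? : ∀ {m n} (G : BipGraph m n) → Dec (C₄-Free G)
C₄-free? G = ¬? (map′ (rectangle⇒K₂₂ G) (K₂₂⇒rectangle G) (rectangle? G))

allVecs : ∀ {A : Set} → List A → ∀ n → List (Vec A n)
allVecs xs zero    = List.[ [] ]
allVecs xs (suc n) = cartesianProductWith _∷_ xs (allVecs xs n)

allSubsets : ∀ n → List (Subset n)
allSubsets = allVecs (true List.∷ false List.∷ List.[])

allBipGraphs : ∀ m n → List (BipGraph m n)
allBipGraphs m n = allVecs (allSubsets n) m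

-- The Zarankiewicz number z(n,n;2,2). The default value 0 is harmless because
-- the edgeless graph is C₄-free; see z-attained and z-upper.
z : ℕ → ℕ
z n = max 0 (List.map edges (filter C₄-free? (allBipGraphs n n)))

allVecs-complete : ∀ {A : Set} {xs : List A} → (∀ x → x ∈ₗ xs) →
                   ∀ {n} (v : Vec A n) → v ∈ₗ allVecs xs n
allVecs-complete c []      = here refl
allVecs-complete c (x ∷ v) = ∈-cartesianProductWith⁺ _∷_ (c x) (allVecs-complete c v)

allBipGraphs-complete : ∀ {m n} (G : BipGraph m n) → G ∈ₗ allBipGraphs m n
allBipGraphs-complete = allVecs-complete (allVecs-complete λ
  { true → here refl ; false → there (here refl) })

z-upper : ∀ {n} (G : BipGraph n n) → C₄-Free G → edges G ≤ z n
z-upper G free = All.lookup (xs≤max 0 _)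
  (∈-map⁺ edges (∈-filter⁺ C₄-free? (allBipGraphs-complete G) free))

z-attained : ∀ n → ∃ λ (G : BipGraph n n) → C₄-Free G × edges G ≡ z n
z-attained n = argmax-all id {P = λ e → ∃ λ (G : BipGraph n n) → C₄-Free G × edges G ≡ e}
  (edgeless n , edgeless-free , edges-edgeless n)
  (map⁺ (All.map (λ {G} free → G , free , refl) (all-filter C₄-free? (allBipGraphs n n))))
  where
  edgeless : ∀ m → BipGraph m n
  edgeless m = replicate m Subset.⊥

  edges-edgeless : ∀ m → edges (edgeless m) ≡ 0
  edges-edgeless zero    = refl
  edges-edgeless (suc m) = cong₂ _+_ (∣⊥∣≡0 n) (edges-edgeless m)

  edgeless-free : C₄-Free (edgeless n)
  edgeless-free c with K₂₂⇒rectangle (edgeless n) c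
  ... | i , _ , j , _ , _ , _ , ij , _ = ∉⊥ (subst (j ∈_) (lookup-replicate i Subset.⊥) ij)

bound : ℤ → Fin 5 → ℤ
bound k 0F = k ^ᶻ 3 +ᶻ + 2 *ᶻ k ^ᶻ 2 +ᶻ + 2 *ᶻ k +ᶻ + 1
bound k 1F = k ^ᶻ 3 +ᶻ + 2 *ᶻ k ^ᶻ 2
bound k 2F = k ^ᶻ 3 +ᶻ + 2 *ᶻ k ^ᶻ 2 -ᶻ + 2 *ᶻ k
bound k 3F = k ^ᶻ 3 +ᶻ + 2 *ᶻ k ^ᶻ 2 -ᶻ + 4 *ᶻ k +ᶻ + 1
bound k 4F = k ^ᶻ 3 +ᶻ + 2 *ᶻ k ^ᶻ 2 -ᶻ + 6 *ᶻ k +ᶻ + 2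

{-# OPTIONS --safe #-}
module Submission where

-- For k = p^a, the algebra F_p[X]/(X^(k-1) - 1) satisfies x^k = x identically.  The product u of the
-- X^(p^d) - X with 0 < d < a is monic of degree less than k - 1, hence nonzero, so some maximal ideal
-- contains the annihilator of u but not u itself; in the residue field the conjugates X^(p^i), i < a,
-- are distinct.  A polynomial over F_p of degree < a cannot vanish at all of them, so the residue field
-- has at least p^a elements, and no more because all are roots of T^k - T.
--
-- The incidence graph of the projective plane over this field is C₄-free and (k+1)-regular, with
-- k^2 + k + 1 vertices on each side.  For h > 0 one deletes h points and h lines with as many mutual
-- incidences as possible: an incident pair (1), then 3, then a triangle (6), and finally a triangle with a
-- point on one side and the line joining it to the opposite vertex (9).

open import Algebra.Bundles using (CommutativeRing)
import Algebra.Construct.Pointwise as Pointwise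
import Algebra.Properties.CommutativeSemiring.Binomial as Binomial
import Algebra.Properties.CommutativeSemiring.Exp as CommutativeExp
import Algebra.Properties.Ring
import Algebra.Properties.Semiring.Exp as Exp
import Algebra.Properties.Semiring.Mult as Mult
import Algebra.Properties.Semiring.Sum as Sum
open import Data.Empty using (⊥-elim)
open import Data.Fin using (Fin; zero; suc; toℕ; fromℕ; inject₁; fromℕ<; combine; finToFun; funToFin)
open import Data.Fin.Properties using (0≢1+n; suc-injective; toℕ-fromℕ; toℕ-inject₁; toℕ<n; toℕ-fromℕ<; toℕ-injective; funToFin-finToFin; any?; all?)
open import Data.Integer as ℤ using (ℤ; +_; -[1+_])
open import Data.Integer.DivMod using (_%ℕ_; _/ℕ_; a≡a%ℕn+[a/ℕn]*n; n%ℕd<d)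
open import Data.Integer.Divisibility.Signed as ℤ using (divides)
import Data.Integer.Properties as ℤ
open import Data.List using (List; []; _∷_; cartesianProductWith; [_]; map; upTo)
open import Data.List.Membership.Propositional using (lose)
open import Data.List.Membership.Propositional.Properties using (∈-map⁺; ∈-upTo⁺)
open import Data.List.Relation.Unary.Any as Any using (Any; here; there; satisfied)
open import Data.List.Relation.Unary.Any.Properties using (cartesianProductWith⁺)
open import Data.Nat as ℕ using (ℕ; zero; suc; _∸_; _!; _<_; _≤_; z<s; s<s; s≤s; z≤n)
open import Data.Nat.Combinatorics using (_C_; nCk≡n!/k![n-k]!; k![n∸k]!∣n!; nCn≡1)
open import Data.Nat.Coprimality using (prime⇒coprime; coprime-Bézout)
open import Data.Nat.DivMod using (m/n*n≡m)
open import Data.Nat.Divisibility using (_∣_; divides; >⇒∤; m∣m*n; ∣1⇒≡1)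
open import Data.Nat.GCD using (module Bézout)
open import Data.Nat.Primality using (Prime; euclidsLemma; prime⇒nonZero; ¬prime[0]; ¬prime[1]; prime⇒nonTrivial)
import Data.Nat.Properties as ℕ
open import Data.Nat.Tactic.RingSolver using (solve-∀)
open import Data.Product using (∃; _×_; _,_; proj₁; proj₂)
open import Data.Sum using (_⊎_; inj₁; inj₂)
open import Data.Vec as Vec using (Vec; []; _∷_; lookup; zipWith)
open import Data.Vec.Functional using (replicate; Vector) renaming ([] to []ᶠ; _∷_ to _∷ᶠ_)
open import Data.Vec.Properties using (lookup∘tabulate; lookup-zipWith)
open import Data.Vec.Relation.Unary.All using (All; []; _∷_)
import Data.Vec.Relation.Unary.All.Properties as VecAll
open import Function using (_∘_)
open import Level using (0ℓ)
open import Relation.Binary.Definitions using (tri<; tri≈; tri>) renaming (Decidable to Decidable₂)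
open import Relation.Binary.PropositionalEquality as ≡ using (_≡_; cong; subst; cong₂)
import Relation.Binary.Reasoning.Setoid as ≈-Reasoning
open import Relation.Nullary using (¬_; yes; no)
open import Relation.Nullary.Decidable using (map′; decidable-stable)
open import Relation.Unary using (Decidable)

-- Ideals and quotient rings

-- The obstacle is the existence of a field of order p^a: the usual routes through a splitting field
-- or a count of irreducible polynomials need much more algebra. The cyclic algebra is written down
-- outright, is finite and has decidable equality, so that a maximal ideal can be found by search.
--
-- It satisfies x^k = x because the solutions of this equation form a subring, the Frobenius map
-- being additive, and this subring contains the scalars, and X because X^(k-1) = 1. Throughout, `l`
-- stands for k - 2, so that X has order `suc l`.
--
-- Deleting h points and h lines with i mutual incidences leaves (k+1)(k^2+k+1) - 2h(k+1) + i edges,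
-- as each mutual incidence is subtracted twice. The five bounds are the values of this expression,
-- with i = 0 for h = 0.

Ring₀ : Set₁
Ring₀ = CommutativeRing 0ℓ 0ℓ

record Ideal (R : Ring₀) : Set₁ where
  no-eta-equality
  open CommutativeRing R
  infix 4 _∈I
  field
    _∈I  : Carrier → Set
    resp : ∀ {x y} → x ≈ y → x ∈I → y ∈I
    0∈I  : 0# ∈I
    +-closed : ∀ {x y} → x ∈I → y ∈I → x + y ∈I
    *-closed : ∀ t {x} → x ∈I → t * x ∈I

  -‿closed : ∀ {x} → x ∈I → - x ∈I
  -‿closed {x} x∈ = resp (-1*x≈-x x) (*-closed (- 1#) x∈)
    where open Algebra.Properties.Ring ring

module Differences (R : Ring₀) where
  open CommutativeRing R
  open Algebra.Properties.Ring ring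
    using (-‿+-comm; -‿involutive; -‿distribʳ-*; -‿distribˡ-*; -0#≈0#) public
  open import Algebra.Properties.CommutativeSemigroup +-commutativeSemigroup using (interchange) public
  open ≈-Reasoning setoid

  -‿flip : ∀ x y → - (x - y) ≈ y - x
  -‿flip x y = begin
    - (x - y)     ≈⟨ -‿+-comm x (- y) ⟨
    - x - - y     ≈⟨ +-congˡ (-‿involutive y) ⟩
    - x + y       ≈⟨ +-comm _ _ ⟩
    y - x         ∎

  -‿telescope : ∀ x y z → (x - y) + (y - z) ≈ x - z
  -‿telescope x y z = begin
    (x - y) + (y - z)    ≈⟨ +-assoc _ _ _ ⟩
    x + (- y + (y - z))  ≈⟨ +-congˡ (+-assoc _ _ _) ⟨
    x + ((- y + y) - z)  ≈⟨ +-congˡ (+-congʳ (-‿inverseˡ y)) ⟩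
    x + (0# - z)         ≈⟨ +-congˡ (+-identityˡ _) ⟩
    x - z                ∎

  +-difference : ∀ x x′ y y′ → (x - x′) + (y - y′) ≈ (x + y) - (x′ + y′)
  +-difference x x′ y y′ = trans (interchange _ _ _ _) (+-congˡ (-‿+-comm x′ y′))

  distribʳ-difference : ∀ z x y → (x - y) * z ≈ x * z - y * z
  distribʳ-difference z x y = trans (distribʳ z x (- y)) (+-congˡ (sym (-‿distribˡ-* y z)))

  distribˡ-difference : ∀ z x y → z * (x - y) ≈ z * x - z * y
  distribˡ-difference z x y = trans (distribˡ z x (- y)) (+-congˡ (sym (-‿distribʳ-* z y)))

module _ (R : Ring₀) (I : Ideal R) where
  open CommutativeRing R
  open Ideal I
  open Differences R

  infix 4 _≈I_
  _≈I_ : Carrier → Carrier → Set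
  x ≈I y = x - y ∈I

  ≈⇒≈I : ∀ {x y} → x ≈ y → x ≈I y
  ≈⇒≈I {x} {y} x≈y = resp (sym (trans (+-congʳ x≈y) (-‿inverseʳ y))) 0∈I

  -- The carrier stays and only the equality is coarsened. Ring laws are inherited through `≈⇒≈I`,
  -- no representatives are chosen, and a decidable ideal gives decidable equality.
  quotient : Ring₀
  quotient = record
    { Carrier = Carrier ; _≈_ = _≈I_ ; _+_ = _+_ ; _*_ = _*_ ; -_ = -_ ; 0# = 0# ; 1# = 1#
    ; isCommutativeRing = record
      { isRing = record
        { +-isAbelianGroup = record
          { isGroup = record
            { isMonoid = record
              { isSemigroup = record
                { isMagma = record
                  { isEquivalence = record
                    { refl  = ≈⇒≈I refl
                    ; sym   = λ {x} {y} xy → resp (-‿flip x y) (-‿closed xy)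
                    ; trans = λ {x} {y} {z} xy yz → resp (-‿telescope x y z) (+-closed xy yz)
                    }
                  ; ∙-cong = λ {x} {x′} {y} {y′} p q → resp (+-difference x x′ y y′) (+-closed p q)
                  }
                ; assoc = λ x y z → ≈⇒≈I (+-assoc x y z)
                }
              ; identity = (λ x → ≈⇒≈I (+-identityˡ x)) , (λ x → ≈⇒≈I (+-identityʳ x))
              }
            ; inverse = (λ x → ≈⇒≈I (-‿inverseˡ x)) , (λ x → ≈⇒≈I (-‿inverseʳ x))
            ; ⁻¹-cong = λ {x} {y} p → resp (sym (-‿+-comm x (- y))) (-‿closed p)
            }
          ; comm = λ x y → ≈⇒≈I (+-comm x y)
          }
        ; *-cong = λ {x} {x′} {y} {y′} p q → resp
            (trans (+-cong (trans (*-comm _ _) (distribʳ-difference y x x′)) (distribˡ-difference x′ y y′))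
                   (-‿telescope _ _ _))
            (+-closed (*-closed y p) (*-closed x′ q))
        ; *-assoc = λ x y z → ≈⇒≈I (*-assoc x y z)
        ; *-identity = (λ x → ≈⇒≈I (*-identityˡ x)) , (λ x → ≈⇒≈I (*-identityʳ x))
        ; distrib = (λ x y z → ≈⇒≈I (distribˡ x y z)) , (λ x y z → ≈⇒≈I (distribʳ x y z))
        }
      ; *-comm = λ x y → ≈⇒≈I (*-comm x y)
      }
    }

module _ (R : Ring₀) where
  open CommutativeRing R
  open Ideal
  open Differences R

  -- Phrased by elements rather than by comparison with larger ideals: the second alternative is an
  -- inverse of x modulo M, which is what makes the quotient a domain constructively.
  Maximal : Ideal R → Set
  Maximal M = (¬ _∈I M 1#) × (∀ x → _∈I M x ⊎ ∃ λ t → _∈I M (1# - t * x))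

  annihilator : Carrier → Ideal R
  annihilator u = record
    { _∈I      = λ x → x * u ≈ 0#
    ; resp     = λ x≈y xu → trans (*-congʳ (sym x≈y)) xu
    ; 0∈I      = zeroˡ u
    ; +-closed = λ {x} {y} xu yu → trans (distribʳ u x y) (trans (+-cong xu yu) (+-identityˡ 0#))
    ; *-closed = λ t {x} xu → trans (*-assoc t x u) (trans (*-congˡ xu) (zeroʳ t))
    }

  adjoin : Ideal R → Carrier → Ideal R
  adjoin I r = record
    { _∈I      = λ x → ∃ λ t → _∈I I (x - t * r)
    ; resp     = λ { x≈y (t , m) → t , resp I (+-congʳ x≈y) m }
    ; 0∈I      = 0# , ≈⇒≈I R I (sym (zeroˡ r))
    ; +-closed = λ { {x} {y} (s , m) (t , n) → s + t ,
        resp I (trans (+-difference x _ y _) (+-congˡ (-‿cong (sym (distribʳ r s t))))) (+-closed I m n) }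
    ; *-closed = λ { s {x} (t , m) → s * t ,
        resp I (trans (distribˡ-difference s x _) (+-congˡ (-‿cong (sym (*-assoc s t r))))) (*-closed I s m) }
    }

  ⊆-adjoin : ∀ I r {x} → _∈I I x → _∈I (adjoin I r) x
  ⊆-adjoin I r x∈ = 0# , resp I (sym (trans (+-congˡ (trans (-‿cong (zeroˡ r)) -0#≈0#)) (+-identityʳ _))) x∈

  ∈-adjoin : ∀ I r → _∈I (adjoin I r) r
  ∈-adjoin I r = 1# , ≈⇒≈I R I (sym (*-identityˡ r))

  module _ (xs : List Carrier) (cover : ∀ x → Any (x ≈_) xs) where

    adjoin? : ∀ I r → Decidable (_∈I I) → Decidable (_∈I (adjoin I r))
    adjoin? I r I? x = map′ satisfied
      (λ { (t , m) → Any.map (λ t≈s → resp I (+-congˡ (-‿cong (*-congʳ t≈s))) m) (cover t) })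
      (Any.any? (λ t → I? (x - t * r)) xs)

    -- Greedy construction: run through the ring, adjoining each element that keeps the ideal proper.
    maximal-above : ∀ I → Decidable (_∈I I) → ¬ _∈I I 1# →
                    ∃ λ M → (∀ {x} → _∈I I x → _∈I M x) × Decidable (_∈I M) × Maximal M
    maximal-above I I? I≠R with go xs I I? I≠R
      where
      go : ∀ ys I → Decidable (_∈I I) → ¬ _∈I I 1# →
           ∃ λ M → (∀ {x} → _∈I I x → _∈I M x) × Decidable (_∈I M) × (¬ _∈I M 1#) ×
                   (∀ {x} → Any (x ≈_) ys → _∈I M x ⊎ ∃ λ t → _∈I M (1# - t * x))
      go [] I I? I≠R = I , (λ x∈ → x∈) , I? , I≠R , λ ()
      go (y ∷ ys) I I? I≠R with adjoin? I y I? 1#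
      ... | yes (t , m) = let M , I⊆M , M? , M≠R , alt = go ys I I? I≠R in
        M , I⊆M , M? , M≠R , λ
          { (here x≈y) → inj₂ (t , I⊆M (resp I (+-congˡ (-‿cong (*-congˡ (sym x≈y)))) m))
          ; (there x∈) → alt x∈ }
      ... | no Iy≠R = let M , Iy⊆M , M? , M≠R , alt = go ys (adjoin I y) (adjoin? I y I?) Iy≠R in
        M , (λ x∈ → Iy⊆M (⊆-adjoin I y x∈)) , M? , M≠R , λ
          { (here x≈y) → inj₁ (resp M (sym x≈y) (Iy⊆M (∈-adjoin I y)))
          ; (there x∈) → alt x∈ }
    ... | M , I⊆M , M? , M≠R , alt = M , I⊆M , M? , M≠R , λ x → alt (cover x)

IsDomain : Ring₀ → Set
IsDomain R = ¬ 1# ≈ 0# × ∀ {x y} → x * y ≈ 0# → ¬ x ≈ 0# → y ≈ 0#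
  where open CommutativeRing R

module _ (R : Ring₀) (M : Ideal R) where
  open Differences R
  private module R = CommutativeRing R
  open CommutativeRing (quotient R M)
  open Ideal M
  open ≈-Reasoning setoid

  ∈I⇒≈0 : ∀ {x} → x ∈I → x ≈ 0#
  ∈I⇒≈0 {x} = resp (R.sym (R.trans (R.+-congˡ -0#≈0#) (R.+-identityʳ x)))

  ≈0⇒∈I : ∀ {x} → x ≈ 0# → x ∈I
  ≈0⇒∈I {x} = resp (R.trans (R.+-congˡ -0#≈0#) (R.+-identityʳ x))

  maximal⇒domain : Maximal R M → IsDomain (quotient R M)
  maximal⇒domain (M≠R , alt) = (λ 1≈0 → M≠R (≈0⇒∈I 1≈0)) , cancel
    where
    cancel : ∀ {x y} → x * y ≈ 0# → ¬ x ≈ 0# → y ≈ 0#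
    cancel {x} {y} xy≈0 x≉0 with alt x
    ... | inj₁ x∈ with () ← x≉0 (∈I⇒≈0 x∈)
    ... | inj₂ (t , 1≈tx) = begin
      y            ≈⟨ *-identityˡ y ⟨
      1# * y       ≈⟨ *-congʳ {y} {1#} {t * x} 1≈tx ⟩
      t * x * y    ≈⟨ *-assoc t x y ⟩
      t * (x * y)  ≈⟨ *-congˡ {t} {x * y} {0#} xy≈0 ⟩
      t * 0#       ≈⟨ zeroʳ t ⟩
      0#           ∎

-- Polynomials and their roots

module Polynomials (R : Ring₀) where
  open CommutativeRing R hiding (zero)
  open Differences R
  open Exp semiring using (_^_)
  open ≈-Reasoning setoid
  open import Algebra.Properties.CommutativeSemigroup +-commutativeSemigroup using (x∙yz≈y∙xz)
  open import Algebra.Properties.CommutativeSemigroup *-commutativeSemigroup using () renaming (x∙yz≈y∙xz to x*yz≈y*xz)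

  -- Coefficients are listed from the constant term upwards.
  eval : ∀ {n} → Vec Carrier n → Carrier → Carrier
  eval []       t = 0#
  eval (a ∷ as) t = a + t * eval as t

  eval-difference : ∀ {n} (as bs : Vec Carrier n) t → eval (zipWith _-_ as bs) t ≈ eval as t - eval bs t
  eval-difference []       []       t = sym (-‿inverseʳ 0#)
  eval-difference (a ∷ as) (b ∷ bs) t = begin
    a - b + t * eval (zipWith _-_ as bs) t         ≈⟨ +-congˡ (*-congˡ (eval-difference as bs t)) ⟩
    a - b + t * (eval as t - eval bs t)            ≈⟨ +-congˡ (distribˡ-difference t _ _) ⟩
    a - b + (t * eval as t - t * eval bs t)        ≈⟨ +-difference _ _ _ _ ⟩
    (a + t * eval as t) - (b + t * eval bs t)      ∎

  -- The quotient of a ∷ as by T - r is synthetic r as, by Horner's scheme.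
  synthetic : ∀ {n} → Carrier → Vec Carrier n → Vec Carrier n
  synthetic r []       = []
  synthetic r (a ∷ as) = eval (a ∷ as) r ∷ synthetic r as

  -- This is f(t) - f(r) = (t - r) q(t) with the negative terms moved across, so that the induction
  -- involves no subtraction.
  division : ∀ {n} a (as : Vec Carrier n) r t →
             eval (a ∷ as) t + r * eval (synthetic r as) t ≈ eval (a ∷ as) r + t * eval (synthetic r as) t
  division a [] r t = begin
    a + t * 0# + r * 0#  ≈⟨ +-cong (+-congˡ (trans (zeroʳ t) (sym (zeroʳ r)))) (trans (zeroʳ r) (sym (zeroʳ t))) ⟩
    a + r * 0# + t * 0#  ∎
  division a (b ∷ bs) r t = begin
    a + t * g t + r * (g r + t * Q)      ≈⟨ +-congˡ (trans (distribˡ r _ _) (+-congˡ (x*yz≈y*xz r t Q))) ⟩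
    a + t * g t + (r * g r + t * (r * Q))  ≈⟨ +-assoc _ _ _ ⟩
    a + (t * g t + (r * g r + t * (r * Q)))  ≈⟨ +-congˡ (x∙yz≈y∙xz _ _ _) ⟩
    a + (r * g r + (t * g t + t * (r * Q)))  ≈⟨ +-congˡ (+-congˡ (distribˡ t _ _)) ⟨
    a + (r * g r + t * (g t + r * Q))        ≈⟨ +-congˡ (+-congˡ (*-congˡ (division b bs r t))) ⟩
    a + (r * g r + t * (g r + t * Q))        ≈⟨ +-assoc _ _ _ ⟨
    a + r * g r + t * (g r + t * Q)          ∎
    where
    g = eval (b ∷ bs)
    Q = eval (synthetic r bs) t

  synthetic-zero : ∀ {n} (as : Vec Carrier n) r → (∀ i → lookup (synthetic r as) i ≈ 0#) → eval as r ≈ 0#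
  synthetic-zero []       r q≈0 = refl
  synthetic-zero (a ∷ as) r q≈0 = q≈0 zero

  constant-zero : ∀ {n} a (as : Vec Carrier n) r → eval as r ≈ 0# → eval (a ∷ as) r ≈ 0# → a ≈ 0#
  constant-zero a as r as≈0 e = begin
    a                   ≈⟨ +-identityʳ a ⟨
    a + 0#              ≈⟨ +-congˡ (trans (*-congˡ as≈0) (zeroʳ r)) ⟨
    a + r * eval as r   ≈⟨ e ⟩
    0#                  ∎

  -- The Horner values determine the coefficients: each coefficient is its own Horner value minus r
  -- times the next one.
  synthetic-zero⇒zero : ∀ {n} (as : Vec Carrier n) r →
                        (∀ i → lookup (synthetic r as) i ≈ 0#) → ∀ i → lookup as i ≈ 0#
  synthetic-zero⇒zero (a ∷ as) r q≈0 zero    = constant-zero a as r (synthetic-zero as r (q≈0 ∘ suc)) (q≈0 zero)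
  synthetic-zero⇒zero (a ∷ as) r q≈0 (suc i) = synthetic-zero⇒zero as r (q≈0 ∘ suc) i

  x-y≈0⇒x≈y : ∀ {x y} → x - y ≈ 0# → x ≈ y
  x-y≈0⇒x≈y {x} {y} = Algebra.Properties.Ring.x∙y⁻¹≈ε⇒x≈y ring x y

  -- Induction by division by T - r₀: in a domain the remaining roots are roots of the quotient, so
  -- the quotient vanishes, and a vanishing quotient forces a vanishing dividend.
  roots-bound : IsDomain R → ∀ {n} (as : Vec Carrier n) (r : Fin n → Carrier) →
                (∀ {i j} → r i ≈ r j → i ≡ j) → (∀ i → eval as (r i) ≈ 0#) → ∀ i → lookup as i ≈ 0#
  roots-bound dom (a ∷ as) r r-inj root = λ
    { zero    → constant-zero a as r₀ (synthetic-zero as r₀ q≈0) (root zero)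
    ; (suc i) → synthetic-zero⇒zero as r₀ q≈0 i }
    where
    r₀ = r zero
    q≈0 : ∀ i → lookup (synthetic r₀ as) i ≈ 0#
    q≈0 = roots-bound dom (synthetic r₀ as) (r ∘ suc) (λ e → suc-injective (r-inj e)) λ i →
      proj₂ dom (factor i) (λ e → 0≢1+n (r-inj (sym (x-y≈0⇒x≈y e))))
      where
      factor : ∀ i → (r (suc i) - r₀) * eval (synthetic r₀ as) (r (suc i)) ≈ 0#
      factor i = begin
        (t - r₀) * Q       ≈⟨ distribʳ-difference Q t r₀ ⟩
        t * Q - r₀ * Q     ≈⟨ +-congʳ (sym (trans (+-congʳ (root zero)) (+-identityˡ _))) ⟩
        (eval (a ∷ as) r₀ + t * Q) - r₀ * Q  ≈⟨ +-congʳ (division a as r₀ t) ⟨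
        (eval (a ∷ as) t + r₀ * Q) - r₀ * Q  ≈⟨ +-congʳ (trans (+-congʳ (root (suc i))) (+-identityˡ _)) ⟩
        r₀ * Q - r₀ * Q    ≈⟨ -‿inverseʳ _ ⟩
        0#                 ∎
        where
        t = r (suc i)
        Q = eval (synthetic r₀ as) t

  monomial : ∀ n → Vec Carrier (suc n)
  monomial zero    = 1# ∷ []
  monomial (suc n) = 0# ∷ monomial n

  eval-monomial : ∀ n t → eval (monomial n) t ≈ t ^ n
  eval-monomial zero    t = trans (+-congˡ (zeroʳ t)) (+-identityʳ 1#)
  eval-monomial (suc n) t = trans (+-identityˡ _) (*-congˡ (eval-monomial n t))

  power-fixed-bound : IsDomain R → ∀ n (r : Fin (suc (suc (suc n))) → Carrier) →
                      (∀ {i j} → r i ≈ r j → i ≡ j) → ¬ (∀ i → r i ^ suc (suc n) ≈ r i)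
  power-fixed-bound dom n r r-inj fixed = proj₁ dom (begin
    1#        ≈⟨ -‿involutive 1# ⟨
    - (- 1#)  ≈⟨ -‿cong (roots-bound dom f r r-inj root (suc zero)) ⟩
    - 0#      ≈⟨ -0#≈0# ⟩
    0#        ∎)
    where
    -- The polynomial T^(n+2) - T. As the exponent is at least 2, the coefficient of T is exactly
    -- -1, and this is the coefficient that yields the contradiction.
    f : Vec Carrier (suc (suc (suc n)))
    f = 0# ∷ - 1# ∷ monomial n

    root : ∀ i → eval f (r i) ≈ 0#
    root i = begin
      0# + t * (- 1# + t * eval (monomial n) t)  ≈⟨ +-identityˡ _ ⟩
      t * (- 1# + t * eval (monomial n) t)       ≈⟨ *-congˡ (+-congˡ (*-congˡ (eval-monomial n t))) ⟩
      t * (- 1# + t ^ suc n)                     ≈⟨ *-congˡ (+-comm _ _) ⟩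
      t * (t ^ suc n - 1#)                       ≈⟨ distribˡ-difference t _ _ ⟩
      t ^ suc (suc n) - t * 1#                   ≈⟨ +-cong (fixed i) (-‿cong (*-identityʳ t)) ⟩
      t - t                                      ≈⟨ -‿inverseʳ t ⟩
      0#                                         ∎
      where t = r i

-- The Frobenius map

prime∤! : ∀ {p n} → Prime p → n < p → ¬ p ∣ n !
prime∤! {n = zero}  pr _   p∣1 = ¬prime[1] (subst Prime (∣1⇒≡1 p∣1) pr)
prime∤! {n = suc n} pr n<p p∣  with euclidsLemma (suc n) (n !) pr p∣
... | inj₁ p∣n  = >⇒∤ n<p p∣n
... | inj₂ p∣n! = prime∤! pr (ℕ.<-trans (ℕ.n<1+n n) n<p) p∣n!

-- The prime p divides p! = (p C k) k! (p-k)! but neither of the two factorials, whose arguments are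
-- below p.
prime∣C : ∀ {p k} → Prime p → 0 < k → k < p → p ∣ p C k
prime∣C {p@(suc p-1)} {k} pr 0<k k<p
  with euclidsLemma (p C k) d pr (subst (p ∣_) (≡.sym C*d≡p!) (m∣m*n (p-1 !)))
  where
  instance _ = ℕ._!*_!≢0 k (p ∸ k)
  d = k ! ℕ.* (p ∸ k) !
  C*d≡p! : (p C k) ℕ.* d ≡ p !
  C*d≡p! = ≡.trans (cong (ℕ._* d) (nCk≡n!/k![n-k]! (ℕ.<⇒≤ k<p))) (m/n*n≡m (k![n∸k]!∣n! (ℕ.<⇒≤ k<p)))
... | inj₁ p∣C = p∣C
... | inj₂ p∣d with euclidsLemma (k !) ((p ∸ k) !) pr p∣d
... | inj₁ p∣k! = ⊥-elim (prime∤! pr k<p p∣k!)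
... | inj₂ p∣[p-k]! = ⊥-elim (prime∤! pr (ℕ.∸-monoʳ-< 0<k (ℕ.<⇒≤ k<p)) p∣[p-k]!)
prime∣C {zero} pr _ ()

CharDivides : ℕ → Ring₀ → Set
CharDivides p R = p · 1# ≈ 0#
  where
  open CommutativeRing R
  open Mult semiring renaming (_×_ to _·_)

module Frobenius (R : Ring₀) {p} (pr : Prime p) (char : CharDivides p R) where
  open CommutativeRing R hiding (zero)
  open Mult semiring renaming (_×_ to _·_)
  open Sum semiring using (sum; sum-init-last; sum-cong-≋; sum-replicate-zero)
  open Exp semiring
  open CommutativeExp commutativeSemiring using (^-distrib-*)
  open ≈-Reasoning setoid
  open Polynomials R using (eval)

  ∣⇒×≈0 : ∀ {n} x → p ∣ n → n · x ≈ 0#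
  ∣⇒×≈0 {n} x (divides m ≡.refl) = begin
    (m ℕ.* p) · x     ≈⟨ ×-assocˡ x m p ⟨
    m · (p · x)       ≈⟨ ×-congʳ m (×-congʳ p (*-identityˡ x)) ⟨
    m · (p · (1# * x)) ≈⟨ ×-congʳ m (×-assoc-* p 1# x) ⟨
    m · (p · 1# * x)   ≈⟨ ×-congʳ m (trans (*-congʳ char) (zeroˡ x)) ⟩
    m · 0#             ≈⟨ ×-congʳ m (zeroʳ 0#) ⟨
    m · (0# * 0#)      ≈⟨ ×-comm-* m 0# 0# ⟨
    0# * (m · 0#)      ≈⟨ zeroˡ _ ⟩
    0#                 ∎

  frobenius-+ : ∀ x y → (x + y) ^ p ≈ x ^ p + y ^ p
  frobenius-+ x y = lemma p ≡.refl
    where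
    lemma : ∀ n → n ≡ p → (x + y) ^ n ≈ x ^ n + y ^ n
    lemma zero    ≡.refl = ⊥-elim (¬prime[0] pr)
    lemma n@(suc n-1) ≡.refl = begin
      (x + y) ^ n                                      ≈⟨ Binomial.theorem commutativeSemiring n x y ⟩
      term zero + sum (term ∘ suc)                      ≈⟨ +-cong first (sum-init-last (term ∘ suc)) ⟩
      y ^ n + (sum (term ∘ suc ∘ inject₁) + term (fromℕ n))  ≈⟨ +-congˡ (+-cong (sum-cong-≋ middle) final) ⟩
      y ^ n + (sum (replicate n-1 0#) + x ^ n)          ≈⟨ +-congˡ (+-congʳ (sum-replicate-zero n-1)) ⟩
      y ^ n + (0# + x ^ n)                              ≈⟨ +-congˡ (+-identityˡ _) ⟩
      y ^ n + x ^ n                                     ≈⟨ +-comm _ _ ⟩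
      x ^ n + y ^ n                                     ∎
      where
      term = Binomial.binomialTerm commutativeSemiring x y n

      first : term zero ≈ y ^ n
      first = trans (×-homo-1 _) (*-identityˡ _)

      middle : ∀ i → term (suc (inject₁ i)) ≈ 0#
      middle i = ∣⇒×≈0 _ (prime∣C pr z<s (s<s (subst (_< n-1) (≡.sym (toℕ-inject₁ i)) (toℕ<n i))))

      final : term (fromℕ n) ≈ x ^ n
      final rewrite toℕ-fromℕ n-1 | nCn≡1 n | ℕ.n∸n≡0 n-1 = trans (×-homo-1 _) (*-identityʳ _)

  frobenius^-+ : ∀ a x y → (x + y) ^ (p ℕ.^ a) ≈ x ^ (p ℕ.^ a) + y ^ (p ℕ.^ a)
  frobenius^-+ zero    x y = trans (*-identityʳ _) (sym (+-cong (*-identityʳ x) (*-identityʳ y)))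
  frobenius^-+ (suc a) x y = begin
    (x + y) ^ (p ℕ.* p ℕ.^ a)                              ≈⟨ ^-assocʳ (x + y) p _ ⟨
    ((x + y) ^ p) ^ (p ℕ.^ a)                              ≈⟨ ^-congˡ (p ℕ.^ a) (frobenius-+ x y) ⟩
    (x ^ p + y ^ p) ^ (p ℕ.^ a)                            ≈⟨ frobenius^-+ a _ _ ⟩
    (x ^ p) ^ (p ℕ.^ a) + (y ^ p) ^ (p ℕ.^ a)              ≈⟨ +-cong (^-assocʳ x p _) (^-assocʳ y p _) ⟩
    x ^ (p ℕ.* p ℕ.^ a) + y ^ (p ℕ.* p ℕ.^ a)              ∎

  Fixed : ℕ → Carrier → Set
  Fixed a x = x ^ (p ℕ.^ a) ≈ x

  fixed-resp : ∀ a {x y} → x ≈ y → Fixed a x → Fixed a y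
  fixed-resp a x≈y fx = trans (^-congˡ (p ℕ.^ a) (sym x≈y)) (trans fx x≈y)

  fixed-+ : ∀ a {x y} → Fixed a x → Fixed a y → Fixed a (x + y)
  fixed-+ a {x} {y} fx fy = trans (frobenius^-+ a x y) (+-cong fx fy)

  fixed-* : ∀ a {x y} → Fixed a x → Fixed a y → Fixed a (x * y)
  fixed-* a {x} {y} fx fy = trans (^-distrib-* x y (p ℕ.^ a)) (*-cong fx fy)

  fixed-1 : ∀ a → Fixed a 1#
  fixed-1 a = 1^n (p ℕ.^ a)
    where
    1^n : ∀ n → 1# ^ n ≈ 1#
    1^n zero    = refl
    1^n (suc n) = trans (*-identityˡ _) (1^n n)

  fixed-0 : ∀ a → Fixed a 0#
  -- The exponent must be positive, since `0# ^ 0` is `1#`.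
  fixed-0 a with p ℕ.^ a | ℕ.m^n>0 p {{prime⇒nonZero pr}} a
  ... | suc n | _ = zeroˡ _

  fixed-- : ∀ a {x} → Fixed a x → Fixed a (- x)
  fixed-- a {x} fx = Algebra.Properties.Ring.+-inverseʳ-unique ring x _ (begin
    x + (- x) ^ (p ℕ.^ a)              ≈⟨ +-congʳ fx ⟨
    x ^ (p ℕ.^ a) + (- x) ^ (p ℕ.^ a)  ≈⟨ frobenius^-+ a x (- x) ⟨
    (x - x) ^ (p ℕ.^ a)                ≈⟨ ^-congˡ (p ℕ.^ a) (-‿inverseʳ x) ⟩
    0# ^ (p ℕ.^ a)                     ≈⟨ fixed-0 a ⟩
    0#                                 ∎)

  fixed-×1 : ∀ a n → Fixed a (n · 1#)
  fixed-×1 a zero    = fixed-0 a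
  fixed-×1 a (suc n) = fixed-+ a (fixed-1 a) (fixed-×1 a n)

  -- This power map is a ring endomorphism fixing the coefficients, so it commutes with evaluation.
  -- Two such polynomials that agree at one element therefore agree at all its conjugates.
  eval-^ : ∀ a {n} {as : Vec Carrier n} → All (Fixed a) as → ∀ t →
           eval as (t ^ (p ℕ.^ a)) ≈ eval as t ^ (p ℕ.^ a)
  eval-^ a []         t = sym (fixed-0 a)
  eval-^ a {as = c ∷ as} (fc ∷ fs) t = begin
    c + t ^ q * eval as (t ^ q)      ≈⟨ +-cong (sym fc) (*-congˡ (eval-^ a fs t)) ⟩
    c ^ q + t ^ q * eval as t ^ q    ≈⟨ +-congˡ (^-distrib-* t _ q) ⟨
    c ^ q + (t * eval as t) ^ q      ≈⟨ frobenius^-+ a c _ ⟨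
    (c + t * eval as t) ^ q          ∎
    where q = p ℕ.^ a

-- Cyclic algebras

-- A[X]/(X^(l+1) - 1) on coefficient vectors: multiplication by X is rotation.
module CyclicAlgebra (A : Ring₀) (l : ℕ) where
  open CommutativeRing A hiding (zero)

  V : Set
  V = Vector Carrier (suc l)

  module V = CommutativeRing (Pointwise.commutativeRing (Fin (suc l)) A)

  open import Algebra.Properties.CommutativeSemigroup V.+-commutativeSemigroup using (interchange)
  open import Algebra.Properties.CommutativeSemigroup *-commutativeSemigroup using (x∙yz≈y∙xz)
  open ≈-Reasoning V.setoid

  rotate : V → V
  rotate v zero    = v (fromℕ l)
  rotate v (suc i) = v (inject₁ i)

  rotate-cong : ∀ {u v} → u V.≈ v → rotate u V.≈ rotate v
  rotate-cong u≈v zero    = u≈v _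
  rotate-cong u≈v (suc i) = u≈v _

  rotate-+ : ∀ u v → rotate (u V.+ v) V.≈ rotate u V.+ rotate v
  rotate-+ u v zero    = refl
  rotate-+ u v (suc i) = refl

  infixr 7 _•_
  _•_ : Carrier → V → V
  (c • v) i = c * v i

  rotate-• : ∀ c v → rotate (c • v) V.≈ c • rotate v
  rotate-• c v zero    = refl
  rotate-• c v (suc i) = refl

  rotate-0 : rotate V.0# V.≈ V.0#
  rotate-0 zero    = refl
  rotate-0 (suc i) = refl

  unit : V
  unit zero    = 1#
  unit (suc _) = 0#

  -- The polynomial f in the operator `rotate`, applied to v by Horner's scheme; for n = l + 1 this
  -- is cyclic convolution. The length of f is independent of that of v, so that induction can
  -- shorten f alone.
  act : ∀ {n} → Vector Carrier n → V → V
  act {zero}  f v = V.0#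
  act {suc n} f v = f zero • v V.+ rotate (act (f ∘ suc) v)

  act-cong : ∀ {n} {f g : Vector Carrier n} {u v} → (∀ i → f i ≈ g i) → u V.≈ v → act f u V.≈ act g v
  act-cong {zero}  f≈g u≈v = V.refl {V.0#}
  act-cong {suc n} f≈g u≈v i = +-cong (*-cong (f≈g zero) (u≈v i)) (rotate-cong (act-cong (f≈g ∘ suc) u≈v) i)

  act-+ʳ : ∀ {n} (f : Vector Carrier n) u v → act f (u V.+ v) V.≈ act f u V.+ act f v
  act-+ʳ {zero}  f u v = V.sym (V.+-identityˡ V.0#)
  act-+ʳ {suc n} f u v = begin
    f zero • (u V.+ v) V.+ rotate (act f′ (u V.+ v))
      ≈⟨ V.+-cong (λ i → distribˡ _ _ _) (V.trans (rotate-cong (act-+ʳ f′ u v)) (rotate-+ _ _)) ⟩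
    (f zero • u V.+ f zero • v) V.+ (rotate (act f′ u) V.+ rotate (act f′ v))
      ≈⟨ interchange _ _ _ _ ⟩
    act f u V.+ act f v ∎
    where f′ = f ∘ suc

  act-+ˡ : ∀ {n} (f g : Vector Carrier n) v → act (λ i → f i + g i) v V.≈ act f v V.+ act g v
  act-+ˡ {zero}  f g v = V.sym (V.+-identityˡ V.0#)
  act-+ˡ {suc n} f g v = begin
    (f zero + g zero) • v V.+ rotate (act (λ i → f′ i + g′ i) v)
      ≈⟨ V.+-cong (λ i → distribʳ _ _ _) (V.trans (rotate-cong (act-+ˡ f′ g′ v)) (rotate-+ _ _)) ⟩
    (f zero • v V.+ g zero • v) V.+ (rotate (act f′ v) V.+ rotate (act g′ v))
      ≈⟨ interchange _ _ _ _ ⟩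
    act f v V.+ act g v ∎
    where
    f′ = f ∘ suc
    g′ = g ∘ suc

  act-• : ∀ {n} (f : Vector Carrier n) c v → act f (c • v) V.≈ c • act f v
  act-• {zero}  f c v i = sym (zeroʳ c)
  act-• {suc n} f c v = begin
    f zero • (c • v) V.+ rotate (act f′ (c • v))
      ≈⟨ V.+-cong (λ i → x∙yz≈y∙xz _ _ _) (V.trans (rotate-cong (act-• f′ c v)) (rotate-• c _)) ⟩
    c • (f zero • v) V.+ c • rotate (act f′ v)
      ≈⟨ (λ i → distribˡ _ _ _) ⟨
    c • act f v ∎
    where f′ = f ∘ suc

  act-rotate : ∀ {n} (f : Vector Carrier n) v → act f (rotate v) V.≈ rotate (act f v)
  act-rotate {zero}  f v = V.sym rotate-0
  act-rotate {suc n} f v = begin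
    f zero • rotate v V.+ rotate (act f′ (rotate v))
      ≈⟨ V.+-cong (V.sym (rotate-• (f zero) v)) (rotate-cong (act-rotate f′ v)) ⟩
    rotate (f zero • v) V.+ rotate (rotate (act f′ v))
      ≈⟨ rotate-+ _ _ ⟨
    rotate (act f v) ∎
    where f′ = f ∘ suc

  act-0 : ∀ {n} (f : Vector Carrier n) → act f V.0# V.≈ V.0#
  act-0 {zero}  f   = V.refl {V.0#}
  act-0 {suc n} f i = trans (+-cong (zeroʳ _) (trans (rotate-cong (act-0 (f ∘ suc)) i) (rotate-0 i))) (+-identityˡ 0#)

  -- Polynomials in one and the same linear operator commute. Commutativity and associativity of the
  -- product are both drawn from this, without manipulating convolution sums.
  act-comm : ∀ {m n} (f : Vector Carrier m) (g : Vector Carrier n) v → act f (act g v) V.≈ act g (act f v)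
  act-comm {n = zero}  f g v = act-0 f
  act-comm {n = suc n} f g v = begin
    act f (g zero • v V.+ rotate (act g′ v))             ≈⟨ act-+ʳ f _ _ ⟩
    act f (g zero • v) V.+ act f (rotate (act g′ v))     ≈⟨ V.+-cong (act-• f _ v) (act-rotate f _) ⟩
    g zero • act f v V.+ rotate (act f (act g′ v))       ≈⟨ V.+-cong (V.refl {g zero • act f v}) (rotate-cong (act-comm f g′ v)) ⟩
    g zero • act f v V.+ rotate (act g′ (act f v))       ∎
    where g′ = g ∘ suc

  pad : ∀ {n} → Vector Carrier n → ℕ → Carrier
  pad {zero}  f k       = 0#
  pad {suc n} f zero    = f zero
  pad {suc n} f (suc k) = pad (f ∘ suc) k

  pad-toℕ : ∀ {n} (f : Vector Carrier n) i → pad f (toℕ i) ≡ f i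
  pad-toℕ f zero    = ≡.refl
  pad-toℕ f (suc i) = pad-toℕ (f ∘ suc) i

  pad-≥ : ∀ {n} (f : Vector Carrier n) {k} → n ≤ k → pad f k ≡ 0#
  pad-≥ {zero}  f z≤n       = ≡.refl
  pad-≥ {suc n} f (s≤s n≤k) = pad-≥ (f ∘ suc) n≤k

  -- With at most l + 1 coefficients nothing wraps around: the entry that rotation brings to index 0
  -- lies beyond the end of the shorter polynomial and is zero.
  act-unit-pad : ∀ {n} (f : Vector Carrier n) → n ≤ suc l → ∀ i → act f unit i ≈ pad f (toℕ i)
  act-unit-pad {zero}  f n≤l i = refl
  act-unit-pad {suc n} f (s≤s n≤l) zero = trans
    (+-cong (*-identityʳ _)
      (trans (act-unit-pad (f ∘ suc) (ℕ.m≤n⇒m≤1+n n≤l) (fromℕ l))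
             (reflexive (pad-≥ (f ∘ suc) (subst (n ≤_) (≡.sym (toℕ-fromℕ l)) n≤l)))))
    (+-identityʳ _)
  act-unit-pad {suc n} f (s≤s n≤l) (suc i) =
    trans (+-cong (zeroʳ _) (act-unit-pad (f ∘ suc) (ℕ.m≤n⇒m≤1+n n≤l) (inject₁ i)))
          (trans (+-identityˡ _) (reflexive (cong (pad (f ∘ suc)) (toℕ-inject₁ i))))

  act-unit : ∀ (v : V) → act v unit V.≈ v
  act-unit v i = trans (act-unit-pad v ℕ.≤-refl i) (reflexive (pad-toℕ v i))

  -- Every vector is its own polynomial applied to `unit`, so commuting operators become commuting
  -- factors.
  act-comm-unit : ∀ (u v : V) → act u v V.≈ act v u
  act-comm-unit u v = begin
    act u v               ≈⟨ act-cong {f = u} (λ i → refl) (V.sym (act-unit v)) ⟩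
    act u (act v unit)    ≈⟨ act-comm u v unit ⟩
    act v (act u unit)    ≈⟨ act-cong {f = v} (λ i → refl) (act-unit u) ⟩
    act v u               ∎

  act-assoc : ∀ (u v w : V) → act (act u v) w V.≈ act u (act v w)
  act-assoc u v w = begin
    act (act u v) w    ≈⟨ act-comm-unit (act u v) w ⟩
    act w (act u v)    ≈⟨ act-comm w u v ⟩
    act u (act w v)    ≈⟨ act-cong {f = u} (λ i → refl) (act-comm-unit w v) ⟩
    act u (act v w)    ∎

  cyclicAlgebra : Ring₀
  cyclicAlgebra = record
    { Carrier = V ; _≈_ = V._≈_ ; _+_ = V._+_ ; _*_ = act {suc l} ; -_ = V.-_ ; 0# = V.0# ; 1# = unit
    ; isCommutativeRing = record
      { isRing = record
        { +-isAbelianGroup = V.+-isAbelianGroup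
        ; *-cong = act-cong {suc l}
        ; *-assoc = act-assoc
        ; *-identity = (λ v → V.trans (act-comm-unit unit v) (act-unit v)) , act-unit
        ; distrib = act-+ʳ {suc l} , λ w u v → act-+ˡ u v w
        }
      ; *-comm = act-comm-unit
      }
    }

  allVectors : ∀ {n} → List Carrier → List (Vector Carrier n)
  allVectors {zero}  xs = [ []ᶠ ]
  allVectors {suc n} xs = cartesianProductWith _∷ᶠ_ xs (allVectors xs)

  allVectors-cover : ∀ {xs} → (∀ x → Any (x ≈_) xs) →
                     ∀ {n} (f : Vector Carrier n) → Any (λ g → ∀ i → f i ≈ g i) (allVectors xs)
  allVectors-cover c {zero}  f = here λ ()
  allVectors-cover c {suc n} f = cartesianProductWith⁺ _∷ᶠ_
    (λ { f₀≈ f′≈ zero → f₀≈ ; f₀≈ f′≈ (suc i) → f′≈ i }) (c (f zero)) (allVectors-cover c (f ∘ suc))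

module _ (A : Ring₀) (l : ℕ) where
  open CyclicAlgebra A l
  private module A = CommutativeRing A
  open CommutativeRing cyclicAlgebra hiding (zero)
  open Exp semiring using (_^_)

  X : Carrier
  X = rotate unit

  X*≈rotate : ∀ v → X * v ≈ rotate v
  X*≈rotate v = begin
    act X v             ≈⟨ act-comm-unit X v ⟩
    act v (rotate unit) ≈⟨ act-rotate v unit ⟩
    rotate (act v unit) ≈⟨ rotate-cong (act-unit v) ⟩
    rotate v            ∎
    where open ≈-Reasoning setoid

  δ : ℕ → ℕ → A.Carrier
  δ zero    zero    = A.1#
  δ (suc i) (suc j) = δ i j
  δ _       _       = A.0#

  δ-diagonal : ∀ i → δ i i ≡ A.1#
  δ-diagonal zero    = ≡.refl
  δ-diagonal (suc i) = δ-diagonal i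

  δ-< : ∀ {i j} → i < j → δ i j ≡ A.0#
  δ-< {zero}  {suc j} _         = ≡.refl
  δ-< {suc i} {suc j} (s≤s i<j) = δ-< i<j

  δ-> : ∀ {i j} → j < i → δ i j ≡ A.0#
  δ-> {suc i} {zero}  _         = ≡.refl
  δ-> {suc i} {suc j} (s≤s i<j) = δ-> i<j

  X^-coefficient : ∀ j → j ≤ l → ∀ i → (X ^ j) i A.≈ δ j (toℕ i)
  X^-coefficient zero    _   zero    = A.refl
  X^-coefficient zero    _   (suc i) = A.refl
  X^-coefficient (suc j) j<l i = A.trans (X*≈rotate (X ^ j) i) (rotated i)
    where
    rotated : ∀ i → rotate (X ^ j) i A.≈ δ (suc j) (toℕ i)
    rotated zero    = A.trans (X^-coefficient j (ℕ.<⇒≤ j<l) (fromℕ l))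
      (A.reflexive (≡.trans (cong (δ j) (toℕ-fromℕ l)) (δ-< j<l)))
    rotated (suc i) = A.trans (X^-coefficient j (ℕ.<⇒≤ j<l) (inject₁ i))
      (A.reflexive (cong (δ j) (toℕ-inject₁ i)))

  X^order≈1 : X ^ suc l ≈ 1#
  X^order≈1 i = A.trans (X*≈rotate (X ^ l) i) (rotated i)
    where
    rotated : ∀ i → rotate (X ^ l) i A.≈ unit i
    rotated zero    = A.trans (X^-coefficient l ℕ.≤-refl (fromℕ l))
      (A.reflexive (≡.trans (cong (δ l) (toℕ-fromℕ l)) (δ-diagonal l)))
    rotated (suc i) = A.trans (X^-coefficient l ℕ.≤-refl (inject₁ i))
      (A.reflexive (δ-> (subst (_< l) (≡.sym (toℕ-inject₁ i)) (toℕ<n i))))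

  Below : ℕ → Carrier → Set
  Below d v = ∀ i → d ≤ toℕ i → v i A.≈ A.0#

  -- For d > l both conditions are vacuous, so degrees add up with no bound to check. Whatever
  -- rotation wraps around lands at index 0, where a vector of positive degree is unconstrained. The
  -- bound on d is demanded only in `monic≉0`.
  record Monic (d : ℕ) (v : Carrier) : Set where
    field
      leading : ∀ i → toℕ i ≡ d → v i A.≈ A.1#
      below   : Below (suc d) v
  open Monic

  below-X* : ∀ {d v} → Below d v → Below (suc d) (X * v)
  below-X* {v = v} b (suc i) (s≤s d≤i) =
    A.trans (X*≈rotate v (suc i)) (b (inject₁ i) (subst (_ ≤_) (≡.sym (toℕ-inject₁ i)) d≤i))

  monic-X* : ∀ {d v} → Monic d v → Monic (suc d) (X * v)
  monic-X* {v = v} m .below = below-X* (m .below)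
  monic-X* {v = v} m .leading (suc i) ≡.refl =
    A.trans (X*≈rotate v (suc i)) (m .leading (inject₁ i) (toℕ-inject₁ i))

  monic-resp : ∀ {d u v} → u ≈ v → Monic d u → Monic d v
  monic-resp u≈v m .leading i e = A.trans (A.sym (u≈v i)) (m .leading i e)
  monic-resp u≈v m .below   i b = A.trans (A.sym (u≈v i)) (m .below i b)

  monic-X^* : ∀ n {d v} → Monic d v → Monic (n ℕ.+ d) (X ^ n * v)
  monic-X^* zero    {v = v} m = monic-resp (sym (*-identityˡ v)) m
  monic-X^* (suc n) {v = v} m = monic-resp (sym (*-assoc X (X ^ n) v)) (monic-X* (monic-X^* n m))

  monic-1 : Monic 0 1#
  monic-1 .leading zero    _ = A.refl
  monic-1 .below   (suc i) _ = A.refl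

  -- As n is at least 2, the degree of X v is below n + d, so subtracting it leaves the leading term
  -- of X^n v alone.
  monic-step : ∀ {n d v} → 2 ≤ n → Monic d v → Monic (n ℕ.+ d) ((X ^ n - X) * v)
  monic-step {n} {d} {v} 2≤n m = monic-resp (sym (distribʳ-difference v (X ^ n) X)) record
    { leading = λ i e → minus (high .leading i e) (low i (ℕ.≤-reflexive (≡.sym e)))
    ; below   = λ i b → A.trans (minus (high .below i b) (low i (ℕ.<⇒≤ b))) A.refl
    }
    where
    open Differences cyclicAlgebra using (distribʳ-difference)
    open Differences A using (-0#≈0#)
    high = monic-X^* n m
    low : Below (n ℕ.+ d) (X * v)
    low i b = below-X* (m .below) i (ℕ.≤-trans (ℕ.+-monoˡ-≤ d 2≤n) b)
    minus : ∀ {x y c} → x A.≈ c → y A.≈ A.0# → x A.- y A.≈ c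
    minus x≈c y≈0 = A.trans (A.+-cong x≈c (A.trans (A.-‿cong y≈0) -0#≈0#)) (A.+-identityʳ _)

  X^order+1≈X : X ^ suc (suc l) ≈ X
  X^order+1≈X = trans (*-congˡ {X} X^order≈1) (*-identityʳ X)

  monic≉0 : ¬ A.1# A.≈ A.0# → ∀ {d v} → d < suc l → Monic d v → ¬ v ≈ 0#
  monic≉0 1≉0 d< m v≈0 = 1≉0 (A.trans (A.sym (m .leading (fromℕ< d<) (toℕ-fromℕ< d<))) (v≈0 (fromℕ< d<)))

-- From a finite field to coordinates

-- What the field structure contributes to the plane: solve m x b stands for m x - b.
record Coordinates (l : ℕ) : Set where
  field
    solve            : (m x b : Fin (suc (suc l))) → Fin (suc (suc l))
    solve-involutive : ∀ m x b → solve m x (solve m x b) ≡ b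
    solve-comm       : ∀ m x b → solve m x b ≡ solve x m b
    solve-zero       : ∀ m → solve m zero zero ≡ zero
    solve-two        : ∀ {m m′ b b′ x x′} → solve m x b ≡ solve m′ x b′ → solve m x′ b ≡ solve m′ x′ b′ →
                       m ≡ m′ ⊎ x ≡ x′

funToFin-cong : ∀ {m n} {f g : Fin m → Fin n} → (∀ i → f i ≡ g i) → funToFin f ≡ funToFin g
funToFin-cong {zero}  f≗g = ≡.refl
funToFin-cong {suc m} f≗g = cong₂ combine (f≗g zero) (funToFin-cong (f≗g ∘ suc))

module _ (K : Ring₀) (dom : IsDomain K) (_≟_ : Decidable₂ (CommutativeRing._≈_ K)) where
  open CommutativeRing K hiding (zero)
  open Differences K
  open Exp semiring using (_^_)
  open Polynomials K
  open ≈-Reasoning setoid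

  bijection⇒coordinates : ∀ {l} (e : Fin (suc (suc l)) → Carrier) → (∀ {i j} → e i ≈ e j → i ≡ j) →
                          e zero ≈ 0# → (index : Carrier → Fin (suc (suc l))) → (∀ y → e (index y) ≈ y) →
                          Coordinates l
  bijection⇒coordinates {l} e e-inj e-zero index e-index = record
    { solve            = λ m x b → index (e m * e x - e b)
    ; solve-involutive = λ m x b → e-inj (begin
        e (index (e m * e x - e (index (e m * e x - e b))))  ≈⟨ e-index _ ⟩
        e m * e x - e (index (e m * e x - e b))              ≈⟨ +-congˡ (-‿cong (e-index _)) ⟩
        e m * e x - (e m * e x - e b)                        ≈⟨ +-congˡ (-‿flip _ _) ⟩
        e m * e x + (e b - e m * e x)                        ≈⟨ +-comm _ _ ⟩
        (e b - e m * e x) + e m * e x                        ≈⟨ +-assoc _ _ _ ⟩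
        e b + (- (e m * e x) + e m * e x)                    ≈⟨ +-congˡ (-‿inverseˡ _) ⟩
        e b + 0#                                             ≈⟨ +-identityʳ _ ⟩
        e b                                                  ∎)
    ; solve-comm       = λ m x b → e-inj
        (trans (e-index _) (trans (+-congʳ (*-comm _ _)) (sym (e-index _))))
    ; solve-zero       = λ m → e-inj (begin
        e (index (e m * e zero - e zero))  ≈⟨ e-index _ ⟩
        e m * e zero - e zero              ≈⟨ +-cong (*-congˡ e-zero) (-‿cong e-zero) ⟩
        e m * 0# - 0#                      ≈⟨ +-cong (zeroʳ _) -0#≈0# ⟩
        0# + 0#                            ≈⟨ +-identityˡ _ ⟩
        0#                                 ≈⟨ e-zero ⟨
        e zero                             ∎)
    ; solve-two        = two
    }
    where
    -- The two equations say (m - m′) x = b - b′ = (m - m′) x′, so (m - m′)(x - x′) = 0 and one of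
    -- the factors vanishes.
    two : ∀ {m m′ b b′ x x′} → index (e m * e x - e b) ≡ index (e m′ * e x - e b′) →
          index (e m * e x′ - e b) ≡ index (e m′ * e x′ - e b′) → m ≡ m′ ⊎ x ≡ x′
    two {m} {m′} {b} {b′} {x} {x′} p q with (e m - e m′) ≟ 0#
    ... | yes m≈m′ = inj₁ (e-inj (x-y≈0⇒x≈y m≈m′))
    ... | no  m≉m′ = inj₂ (e-inj (x-y≈0⇒x≈y (proj₂ dom (begin
      (e m - e m′) * (e x - e x′)                    ≈⟨ distribˡ-difference _ _ _ ⟩
      (e m - e m′) * e x - (e m - e m′) * e x′       ≈⟨ +-cong (slope x p) (-‿cong (slope x′ q)) ⟩
      (e b - e b′) - (e b - e b′)                    ≈⟨ -‿inverseʳ _ ⟩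
      0#                                             ∎) m≉m′)))
      where
      slope : ∀ x → index (e m * e x - e b) ≡ index (e m′ * e x - e b′) → (e m - e m′) * e x ≈ e b - e b′
      slope x eq = begin
        (e m - e m′) * e x          ≈⟨ distribʳ-difference _ _ _ ⟩
        e m * e x - e m′ * e x      ≈⟨ x-y≈0⇒x≈y (begin
          (e m * e x - e m′ * e x) - (e b - e b′)         ≈⟨ +-congˡ (-‿+-comm (e b) (- e b′)) ⟨
          (e m * e x - e m′ * e x) + (- e b - - e b′)     ≈⟨ interchange _ _ _ _ ⟩
          (e m * e x - e b) + (- (e m′ * e x) - - e b′)   ≈⟨ +-congˡ (-‿+-comm _ _) ⟩
          (e m * e x - e b) - (e m′ * e x - e b′)         ≈⟨ +-congʳ same ⟩
          (e m′ * e x - e b′) - (e m′ * e x - e b′)       ≈⟨ -‿inverseʳ _ ⟩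
          0#                                              ∎) ⟩
        e b - e b′                  ∎
        where
        same : e m * e x - e b ≈ e m′ * e x - e b′
        same = trans (sym (e-index _)) (trans (reflexive (cong e eq)) (e-index _))

  +-cancelʳ : ∀ {x y z} → x + z ≈ y + z → x ≈ y
  +-cancelʳ {x} {y} {z} eq = begin
    x            ≈⟨ cancel x ⟨
    x + z - z    ≈⟨ +-congʳ eq ⟩
    y + z - z    ≈⟨ cancel y ⟩
    y            ∎
    where
    cancel : ∀ w → w + z - z ≈ w
    cancel w = trans (+-assoc w z (- z)) (trans (+-congˡ (-‿inverseʳ z)) (+-identityʳ w))

  -- An element missed by e would be one root of T^q - T too many.
  injective⇒surjective : ∀ {l} (e : Fin (suc (suc l)) → Carrier) → (∀ {i j} → e i ≈ e j → i ≡ j) →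
                         (∀ x → x ^ suc (suc l) ≈ x) → ∀ y → ∃ λ i → e i ≈ y
  injective⇒surjective {l} e e-inj fixed y = decidable-stable (any? (λ i → e i ≟ y)) λ missed →
    power-fixed-bound dom l (y ∷ᶠ e) (λ { {i} {j} → inj missed i j }) λ i → fixed ((y ∷ᶠ e) i)
    where
    inj : ¬ (∃ λ i → e i ≈ y) → ∀ i j → (y ∷ᶠ e) i ≈ (y ∷ᶠ e) j → i ≡ j
    inj missed zero    zero    _  = ≡.refl
    inj missed zero    (suc j) eq = ⊥-elim (missed (j , sym eq))
    inj missed (suc i) zero    eq = ⊥-elim (missed (i , eq))
    inj missed (suc i) (suc j) eq = cong suc (e-inj eq)

  coordinates : ∀ {l} (e : Fin (suc (suc l)) → Carrier) → (∀ {i j} → e i ≈ e j → i ≡ j) →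
                (∀ x → x ^ suc (suc l) ≈ x) → Coordinates l
  coordinates e e-inj fixed = bijection⇒coordinates shifted shifted-inj (-‿inverseʳ (e zero))
    (λ y → proj₁ (onto y)) (λ y → proj₂ (onto y))
    where
    -- Translation makes the index `zero` name the element `0#`, as `solve-zero` requires, while
    -- keeping the enumeration injective.
    shifted = λ i → e i - e zero
    shifted-inj : ∀ {i j} → shifted i ≈ shifted j → i ≡ j
    shifted-inj eq = e-inj (+-cancelʳ eq)
    onto = injective⇒surjective shifted shifted-inj fixed

-- Conjugates, and a lower bound for the size of the residue field

module _ (K : Ring₀) (dom : IsDomain K) {p} (pr : Prime p) (char : CharDivides p K) where
  open CommutativeRing K hiding (zero)
  open Differences K
  open Exp semiring
  open Mult semiring renaming (_×_ to _·_)
  open Frobenius K pr char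
  open Polynomials K
  open ≈-Reasoning setoid

  multiple : ∀ m {n} → n · 1# ≈ 0# → (m ℕ.* n) · 1# ≈ 0#
  multiple m {n} n≈0 = trans (×1-homo-* m n) (trans (*-congˡ n≈0) (zeroʳ _))

  -- As n and p are coprime, Bézout's identity turns the vanishing of both n · 1# and p · 1# into 1#
  -- ≈ 0#. The two cases are the two ways of writing the identity in ℕ.
  ×1≉0 : ∀ {n} → n < p → .{{ℕ.NonZero n}} → ¬ n · 1# ≈ 0#
  ×1≉0 {n} n<p n≈0 with coprime-Bézout (prime⇒coprime pr n<p)
  ... | Bézout.+- x y eq = proj₁ dom (begin
    1#                       ≈⟨ +-identityʳ 1# ⟨
    1# + 0#                  ≈⟨ +-congˡ (multiple y n≈0) ⟨
    1# + (y ℕ.* n) · 1#     ≈⟨ ×-congˡ eq ⟩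
    (x ℕ.* p) · 1#          ≈⟨ multiple x char ⟩
    0#                       ∎)
  ... | Bézout.-+ x y eq = proj₁ dom (begin
    1#                       ≈⟨ +-identityʳ 1# ⟨
    1# + 0#                  ≈⟨ +-congˡ (multiple x char) ⟨
    1# + (x ℕ.* p) · 1#     ≈⟨ ×-congˡ eq ⟩
    (y ℕ.* n) · 1#          ≈⟨ multiple y n≈0 ⟩
    0#                       ∎)

  ×1-≮ : ∀ {m n} → m < n → n < p → ¬ m · 1# ≈ n · 1#
  ×1-≮ {m} {n} m<n n<p eq = ×1≉0 (ℕ.≤-<-trans (ℕ.m∸n≤m n m) n<p) {{ℕ.>-nonZero (ℕ.m<n⇒0<n∸m m<n)}} (begin
    (n ℕ.∸ m) · 1#                              ≈⟨ +-identityʳ _ ⟨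
    (n ℕ.∸ m) · 1# + 0#                         ≈⟨ +-congˡ (-‿inverseʳ (m · 1#)) ⟨
    (n ℕ.∸ m) · 1# + (m · 1# - m · 1#)        ≈⟨ +-assoc _ _ _ ⟨
    ((n ℕ.∸ m) · 1# + m · 1#) - m · 1#        ≈⟨ +-congʳ (×-homo-+ 1# (n ℕ.∸ m) m) ⟨
    (n ℕ.∸ m ℕ.+ m) · 1# - m · 1#              ≈⟨ +-congʳ (×-congˡ (ℕ.m∸n+n≡m (ℕ.<⇒≤ m<n))) ⟩
    n · 1# - m · 1#                            ≈⟨ +-congʳ eq ⟨
    m · 1# - m · 1#                            ≈⟨ -‿inverseʳ _ ⟩
    0#                                           ∎)

  ×1-injective : ∀ {m n} → m < p → n < p → m · 1# ≈ n · 1# → m ≡ n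
  ×1-injective {m} {n} m<p n<p eq with ℕ.<-cmp m n
  ... | tri< m<n _ _ = ⊥-elim (×1-≮ m<n n<p eq)
  ... | tri≈ _ m≡n _ = m≡n
  ... | tri> _ _ n<m = ⊥-elim (×1-≮ n<m m<p (sym eq))

  module _ (b : ℕ) (x : Carrier) (x-fixed : Fixed (suc b) x)
           (moved : ∀ d → 1 ≤ d → d ≤ b → ¬ Fixed d x) where

    private
      a = suc b
      -- The base-p digits of the index, taken in the prime field: the indices run through all p^a
      -- polynomials of degree below a.
      coefficients : Fin (p ℕ.^ a) → Vec Carrier a
      coefficients i = Vec.tabulate λ j → toℕ (finToFun {p} {a} i j) · 1#

    -- Raising a coincidence to the power p^(a-i) turns its left side into x^(p^a) = x and its right
    -- side into x^(p^(a+d)) = x^(p^d), against `moved`. Going forward once around the cycle avoids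
    -- cancelling powers of Frobenius.
    conjugates-≮ : ∀ i d → 1 ≤ d → i ℕ.+ d < a → ¬ x ^ (p ℕ.^ i) ≈ x ^ (p ℕ.^ (i ℕ.+ d))
    conjugates-≮ i d 1≤d i+d<a eq = moved d 1≤d (ℕ.≤-trans (ℕ.m≤n+m d i) (ℕ.s≤s⁻¹ i+d<a)) (begin
      x ^ (p ℕ.^ d)                                    ≈⟨ ^-congˡ (p ℕ.^ d) x-fixed ⟨
      (x ^ (p ℕ.^ a)) ^ (p ℕ.^ d)                      ≈⟨ ^-assocʳ x (p ℕ.^ a) (p ℕ.^ d) ⟩
      x ^ (p ℕ.^ a ℕ.* p ℕ.^ d)                        ≈⟨ ^-congʳ x exponents ⟩
      x ^ (p ℕ.^ (i ℕ.+ d) ℕ.* p ℕ.^ c)                ≈⟨ ^-assocʳ x (p ℕ.^ (i ℕ.+ d)) (p ℕ.^ c) ⟨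
      (x ^ (p ℕ.^ (i ℕ.+ d))) ^ (p ℕ.^ c)              ≈⟨ ^-congˡ (p ℕ.^ c) eq ⟨
      (x ^ (p ℕ.^ i)) ^ (p ℕ.^ c)                      ≈⟨ ^-assocʳ x (p ℕ.^ i) (p ℕ.^ c) ⟩
      x ^ (p ℕ.^ i ℕ.* p ℕ.^ c)                        ≈⟨ ^-congʳ x (≡.trans (≡.sym (ℕ.^-distribˡ-+-* p i c)) (cong (p ℕ.^_) i+c≡a)) ⟩
      x ^ (p ℕ.^ a)                                    ≈⟨ x-fixed ⟩
      x                                                ∎)
      where
      c = a ℕ.∸ i
      i+c≡a : i ℕ.+ c ≡ a
      i+c≡a = ℕ.m+[n∸m]≡n (ℕ.≤-trans (ℕ.m≤m+n i d) (ℕ.<⇒≤ i+d<a))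
      swap : ∀ i c d → (i ℕ.+ c) ℕ.+ d ≡ (i ℕ.+ d) ℕ.+ c
      swap = solve-∀
      exponents : p ℕ.^ a ℕ.* p ℕ.^ d ≡ p ℕ.^ (i ℕ.+ d) ℕ.* p ℕ.^ c
      exponents = ≡.trans (≡.sym (ℕ.^-distribˡ-+-* p a d))
        (≡.trans (cong (p ℕ.^_) (≡.trans (cong (ℕ._+ d) (≡.sym i+c≡a)) (swap i c d)))
                 (ℕ.^-distribˡ-+-* p (i ℕ.+ d) c))

    conjugates-< : ∀ {i j} → i < j → j < a → ¬ x ^ (p ℕ.^ i) ≈ x ^ (p ℕ.^ j)
    conjugates-< {i} {j} i<j j<a eq = conjugates-≮ i (j ℕ.∸ i) (ℕ.m<n⇒0<n∸m i<j)
      (subst (_< a) (≡.sym i+[j-i]≡j) j<a) (trans eq (^-congʳ x (cong (p ℕ.^_) (≡.sym i+[j-i]≡j))))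
      where i+[j-i]≡j = ℕ.m+[n∸m]≡n (ℕ.<⇒≤ i<j)

    conjugates-injective : ∀ {i j : Fin a} → x ^ (p ℕ.^ toℕ i) ≈ x ^ (p ℕ.^ toℕ j) → i ≡ j
    conjugates-injective {i} {j} eq with ℕ.<-cmp (toℕ i) (toℕ j)
    ... | tri< i<j _ _ = ⊥-elim (conjugates-< i<j (toℕ<n j) eq)
    ... | tri≈ _ i≡j _ = toℕ-injective i≡j
    ... | tri> _ _ j<i = ⊥-elim (conjugates-< j<i (toℕ<n i) (sym eq))

    combination : Fin (p ℕ.^ a) → Carrier
    combination i = eval (coefficients i) x

    -- A coincidence would be a polynomial over F_p of degree < a vanishing at the a conjugates of x.
    combination-injective : ∀ {i j} → combination i ≈ combination j → i ≡ j
    combination-injective {i} {j} eq = ≡.trans (≡.sym (funToFin-finToFin {a} {p} i))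
      (≡.trans (funToFin-cong (λ s → toℕ-injective (digit s))) (funToFin-finToFin {a} {p} j))
      where
      difference = zipWith _-_ (coefficients i) (coefficients j)

      coefficients-fixed : ∀ s i → All (Fixed s) (coefficients i)
      coefficients-fixed s i = VecAll.tabulate⁺ {P = Fixed s} (λ t → fixed-×1 s (toℕ (finToFun {p} {a} i t)))

      root : ∀ s → eval difference (x ^ (p ℕ.^ toℕ s)) ≈ 0#
      root s = begin
        eval difference y                                ≈⟨ eval-difference (coefficients i) (coefficients j) y ⟩
        eval (coefficients i) y - eval (coefficients j) y
          ≈⟨ +-cong (eval-^ (toℕ s) (coefficients-fixed (toℕ s) i) x) (-‿cong (eval-^ (toℕ s) (coefficients-fixed (toℕ s) j) x)) ⟩
        combination i ^ n - combination j ^ n            ≈⟨ +-congʳ (^-congˡ n eq) ⟩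
        combination j ^ n - combination j ^ n            ≈⟨ -‿inverseʳ _ ⟩
        0#                                               ∎
        where
        n = p ℕ.^ toℕ s
        y = x ^ n

      digit : ∀ s → toℕ (finToFun {p} {a} i s) ≡ toℕ (finToFun {p} {a} j s)
      digit s = ×1-injective (toℕ<n _) (toℕ<n _) (x-y≈0⇒x≈y (trans
        (reflexive (≡.sym (≡.trans (lookup-zipWith _-_ s (coefficients i) (coefficients j))
          (cong₂ _-_ (lookup∘tabulate (λ t → toℕ (finToFun {p} {a} i t) · 1#) s)
                     (lookup∘tabulate (λ t → toℕ (finToFun {p} {a} j t) · 1#) s)))))
        (roots-bound dom difference (λ s → x ^ (p ℕ.^ toℕ s)) conjugates-injective root s)))

-- Finite fields of prime power order

module _ (R : Ring₀) (p : ℕ) where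
  open CommutativeRing R
  open Exp semiring using (_^_)

  -- Nonzero in a field quotient exactly if x is fixed by none of the first d powers of Frobenius.
  movement : Carrier → ℕ → Carrier
  movement x zero    = 1#
  movement x (suc d) = (x ^ (p ℕ.^ suc d) - x) * movement x d

  module _ (I : Ideal R) where
    open Ideal I

    fixed⇒movement∈I : ∀ x {d} n → 1 ≤ d → d ≤ n → x ^ (p ℕ.^ d) - x ∈I → movement x n ∈I
    fixed⇒movement∈I x     zero    (s≤s _) () fx
    fixed⇒movement∈I x {d} (suc n) 1≤d d≤n fx with d ℕ.≟ suc n
    ... | yes ≡.refl = resp (*-comm _ _) (*-closed _ fx)
    ... | no d≢n     = *-closed _ (fixed⇒movement∈I x n 1≤d (ℕ.s≤s⁻¹ (ℕ.≤∧≢⇒< d≤n d≢n)) fx)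

-- Powers and multiples are defined over raw structures that contain the equality, so those of R
-- and of R / I do not agree definitionally.
module _ (R : Ring₀) (I : Ideal R) where
  private
    module R = CommutativeRing R
    module Q = CommutativeRing (quotient R I)
    module R^ = Exp R.semiring
    module Q^ = Exp Q.semiring
    module R× = Mult R.semiring
    module Q× = Mult Q.semiring

  quotient-^ : ∀ x n → x R^.^ n ≡ x Q^.^ n
  quotient-^ x zero    = ≡.refl
  quotient-^ x (suc n) = cong (λ y → x R.* y) (quotient-^ x n)

  quotient-× : ∀ n x → n R×.× x ≡ n Q×.× x
  quotient-× zero    x = ≡.refl
  quotient-× (suc n) x = cong (λ y → x R.+ y) (quotient-× n x)

module _ (R : Ring₀) (xs : List (CommutativeRing.Carrier R))
         (cover : ∀ x → Any (CommutativeRing._≈_ R x) xs) (_≟_ : Decidable₂ (CommutativeRing._≈_ R))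
         {p} (pr : Prime p) (char : CharDivides p R) where
  open CommutativeRing R hiding (zero)
  open Differences R
  open Exp semiring using (_^_)
  open ≈-Reasoning setoid

  finiteRing⇒coordinates : ∀ {l} b → p ℕ.^ suc b ≡ suc (suc l) → (∀ y → y ^ suc (suc l) ≈ y) →
                           ∀ x → ¬ movement R p x b ≈ 0# → Coordinates l
  finiteRing⇒coordinates {l} b q≡ fixed x u≉0 = coordinates K dom (λ y z → M? (y - z))
    (λ i → combination K dom pr charK b x x-fixed x-moved (subst Fin (≡.sym q≡) i))
    (λ eq → subst-injective (combination-injective K dom pr charK b x x-fixed x-moved eq))
    (λ y → subst (λ z → Ideal._∈I M (z - y)) (quotient-^ R M y (suc (suc l))) (≈⇒≈I R M (fixed y)))
    where
    u = movement R p x b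
    max = maximal-above R xs cover (annihilator R u) (λ y → (y * u) ≟ 0#)
            (λ 1u≈0 → u≉0 (trans (sym (*-identityˡ u)) 1u≈0))
    M   = proj₁ max
    Ann⊆M = proj₁ (proj₂ max)
    M?  = proj₁ (proj₂ (proj₂ max))
    M-maximal = proj₂ (proj₂ (proj₂ max))
    K   = quotient R M
    dom = maximal⇒domain R M M-maximal
    charK : CharDivides p K
    charK = subst (λ y → Ideal._∈I M (y - 0#)) (quotient-× R M p 1#) (≈⇒≈I R M char)

    subst-injective : ∀ {m n} {eq : m ≡ n} {i j : Fin m} → subst Fin eq i ≡ subst Fin eq j → i ≡ j
    subst-injective {eq = ≡.refl} e = e

    open Ideal M

    -- Since u^k = u, the element 1 - u^(k-1) annihilates u and so lies in M. If u lay in M too,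
    -- then so would their combination 1.
    u∉M : ¬ u ∈I
    u∉M u∈M = proj₁ M-maximal (resp (begin
      (1# - u ^ suc l) + u ^ suc l        ≈⟨ +-assoc _ _ _ ⟩
      1# + (- u ^ suc l + u ^ suc l)      ≈⟨ +-congˡ (-‿inverseˡ _) ⟩
      1# + 0#                             ≈⟨ +-identityʳ _ ⟩
      1#                                  ∎)
      (+-closed (Ann⊆M annihilates) (resp (*-comm _ _) (*-closed (u ^ l) u∈M))))
      where
      annihilates : (1# - u ^ suc l) * u ≈ 0#
      annihilates = begin
        (1# - u ^ suc l) * u     ≈⟨ distribʳ-difference u _ _ ⟩
        1# * u - u ^ suc l * u   ≈⟨ +-cong (*-identityˡ u) (-‿cong (trans (*-comm _ _) (fixed u))) ⟩
        u - u                    ≈⟨ -‿inverseʳ u ⟩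
        0#                       ∎

    open Exp (CommutativeRing.semiring K) using () renaming (_^_ to _^ᴷ_)

    x-fixed : x ^ᴷ (p ℕ.^ suc b) - x ∈I
    x-fixed = subst (λ z → z - x ∈I) (quotient-^ R M x (p ℕ.^ suc b))
      (≈⇒≈I R M (subst (λ q → x ^ q ≈ x) (≡.sym q≡) (fixed x)))

    x-moved : ∀ d → 1 ≤ d → d ≤ b → ¬ x ^ᴷ (p ℕ.^ d) - x ∈I
    x-moved d 1≤d d≤b fx = u∉M (fixed⇒movement∈I R p M x b 1≤d d≤b
      (subst (λ z → z - x ∈I) (≡.sym (quotient-^ R M x (p ℕ.^ d))) fx))

-- The cyclic algebra over the integers modulo p

module _ (p : ℕ) where

  multiplesOf : Ideal ℤ.+-*-commutativeRing
  multiplesOf = record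
    { _∈I      = λ x → + p ℤ.∣ x
    ; resp     = λ { ≡.refl d → d }
    ; 0∈I      = divides (+ 0) ≡.refl
    ; +-closed = ℤ.∣m∣n⇒∣m+n
    ; *-closed = λ t → ℤ.∣n⇒∣m*n t
    }

  ℤ/p : Ring₀
  ℤ/p = quotient ℤ.+-*-commutativeRing multiplesOf

  private module ℤ/p = CommutativeRing ℤ/p

  residues-cover : .{{ℕ.NonZero p}} → ∀ x → Any (x ℤ/p.≈_) (map +_ (upTo p))
  residues-cover x = lose (∈-map⁺ +_ (∈-upTo⁺ (n%ℕd<d x p))) (divides q (begin
    x ℤ.- r                    ≡⟨ cong (ℤ._- r) (a≡a%ℕn+[a/ℕn]*n x p) ⟩
    r ℤ.+ q ℤ.* + p ℤ.- r      ≡⟨ xyx⁻¹≈y r (q ℤ.* + p) ⟩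
    q ℤ.* + p                  ∎))
    where
    open ≡.≡-Reasoning
    open import Algebra.Properties.AbelianGroup ℤ.+-0-abelianGroup using (xyx⁻¹≈y)
    q = x /ℕ p
    r = + (x %ℕ p)

  ℤ/p-nontrivial : 2 ≤ p → ¬ ℤ/p.1# ℤ/p.≈ ℤ/p.0#
  ℤ/p-nontrivial 2≤p p∣1 = ℕ.<⇒≢ 2≤p (≡.sym (∣1⇒≡1 (ℤ.∣⇒∣ᵤ p∣1)))

  module _ (l : ℕ) where
    open CyclicAlgebra ℤ/p l
    open CommutativeRing cyclicAlgebra hiding (zero)
    open Mult semiring renaming (_×_ to _·_)
    open Exp semiring

    ·1-coefficient : ∀ n i → (n · 1#) i ≡ + n ℤ.* 1# i
    ·1-coefficient zero    i = ≡.refl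
    ·1-coefficient (suc n) i = ≡.trans (cong (λ y → 1# i ℤ.+ y) (·1-coefficient n i)) (≡.sym (ℤ.suc-* (+ n) (1# i)))

    cyclicAlgebra-char : CharDivides p cyclicAlgebra
    cyclicAlgebra-char i = ∈I⇒≈0 _ multiplesOf
      (subst (+ p ℤ.∣_) (≡.sym (·1-coefficient p i)) (ℤ.∣m⇒∣m*n (1# i) (divides (+ 1) (≡.sym (ℤ.*-identityˡ (+ p))))))

    module _ (pr : Prime p) {b} (q≡ : p ℕ.^ suc b ≡ suc (suc l)) where
      open Frobenius cyclicAlgebra pr cyclicAlgebra-char

      scalar-fixed : ∀ c → Fixed (suc b) (c • 1#)
      scalar-fixed (+ n)    = fixed-resp (suc b) (λ i → ℤ/p.reflexive (·1-coefficient n i)) (fixed-×1 (suc b) n)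
      scalar-fixed -[1+ n ] = fixed-resp (suc b)
        (λ i → ℤ/p.reflexive (≡.trans (cong ℤ.-_ (·1-coefficient (suc n) i)) (ℤ.neg-distribˡ-* (+ suc n) (1# i))))
        (fixed-- (suc b) (fixed-×1 (suc b) (suc n)))

      X-fixed : Fixed (suc b) (X ℤ/p l)
      X-fixed = subst (λ q → X ℤ/p l ^ q ≈ X ℤ/p l) (≡.sym q≡) (X^order+1≈X ℤ/p l)

      act-fixed : ∀ {n} (f : Vector ℤ n) → Fixed (suc b) (act f 1#)
      act-fixed {zero}  f = fixed-0 (suc b)
      act-fixed {suc n} f = fixed-+ (suc b) (scalar-fixed (f zero))
        (fixed-resp (suc b) (X*≈rotate ℤ/p l (act (f ∘ suc) 1#)) (fixed-* (suc b) X-fixed (act-fixed (f ∘ suc))))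

      all-fixed : ∀ v → v ^ suc (suc l) ≈ v
      all-fixed v = subst (λ q → v ^ q ≈ v) q≡ (fixed-resp (suc b) (act-unit v) (act-fixed v))

    movementDegree : ℕ → ℕ
    movementDegree zero    = 0
    movementDegree (suc d) = p ℕ.^ suc d ℕ.+ movementDegree d

    movement-monic : 2 ≤ p → ∀ d → Monic ℤ/p l (movementDegree d) (movement cyclicAlgebra p (X ℤ/p l) d)
    movement-monic 2≤p zero    = monic-1 ℤ/p l
    movement-monic 2≤p (suc d) = monic-step ℤ/p l 2≤p^ (movement-monic 2≤p d)
      where
      2≤p^ : 2 ≤ p ℕ.^ suc d
      2≤p^ = ℕ.≤-trans 2≤p (ℕ.m≤m*n p (p ℕ.^ d) {{ℕ.>-nonZero (ℕ.m^n>0 p {{ℕ.>-nonZero (ℕ.≤-trans (s≤s z≤n) 2≤p)}} d)}})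

    -- The geometric sum p + ... + p^d is at most p^(d+1) - 2, with equality for p = 2. The summand
    -- 2 is just what `monic≉0` needs: degree below k - 1 means degree + 2 at most k.
    movementDegree-< : 2 ≤ p → ∀ d → 2 ℕ.+ movementDegree d ≤ p ℕ.^ suc d
    movementDegree-< 2≤p zero    = subst (2 ≤_) (≡.sym (ℕ.*-identityʳ p)) 2≤p
    movementDegree-< 2≤p (suc d) = begin
      2 ℕ.+ (p ℕ.^ suc d ℕ.+ D)       ≡⟨ cong (2 ℕ.+_) (ℕ.+-comm _ D) ⟩
      2 ℕ.+ (D ℕ.+ p ℕ.^ suc d)       ≡⟨ ℕ.+-assoc 2 D _ ⟨
      2 ℕ.+ D ℕ.+ p ℕ.^ suc d         ≤⟨ ℕ.+-monoˡ-≤ _ (movementDegree-< 2≤p d) ⟩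
      p ℕ.^ suc d ℕ.+ p ℕ.^ suc d     ≡⟨ cong (p ℕ.^ suc d ℕ.+_) (ℕ.+-identityʳ _) ⟨
      2 ℕ.* p ℕ.^ suc d               ≤⟨ ℕ.*-monoˡ-≤ _ 2≤p ⟩
      p ℕ.* p ℕ.^ suc d               ∎
      where
      open ℕ.≤-Reasoning
      D = movementDegree d

    movement≉0 : 2 ≤ p → ∀ b → p ℕ.^ suc b ≡ suc (suc l) → ¬ movement cyclicAlgebra p (X ℤ/p l) b ≈ 0#
    movement≉0 2≤p b q≡ = monic≉0 ℤ/p l (ℤ/p-nontrivial 2≤p)
      (ℕ.s≤s⁻¹ (subst (2 ℕ.+ movementDegree b ≤_) q≡ (movementDegree-< 2≤p b))) (movement-monic 2≤p b)

    primePower⇒coordinates : Prime p → ∀ b → p ℕ.^ suc b ≡ suc (suc l) → Coordinates l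
    primePower⇒coordinates pr b q≡ =
      finiteRing⇒coordinates cyclicAlgebra (allVectors (map +_ (upTo p)))
        (allVectors-cover (residues-cover {{prime⇒nonZero pr}}))
        (λ u v → all? λ i → + p ℤ.∣? (u i ℤ.- v i))
        pr cyclicAlgebra-char b q≡ (all-fixed pr {b} q≡) (X ℤ/p l)
        (movement≉0 (ℕ.nonTrivial⇒n>1 p {{prime⇒nonTrivial pr}}) b q≡)

open import Data.Bool using (Bool; true; false; if_then_else_)
open import Data.Empty using (⊥)
open import Data.Fin.Patterns using (0F; 1F; 2F; 3F; 4F)
import Data.Fin.Properties as Fin
open import Data.Fin.Subset using (_∈_; ∣_∣)
open import Data.Integer using () renaming (_≥_ to _≥ᶻ_)
import Data.Integer.Tactic.RingSolver as ℤSolver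
open import Data.List as List using (_++_; allFin; tabulate; drop; length)
open import Data.List.Membership.Propositional using () renaming (_∈_ to _∈ₗ_)
open import Data.List.Membership.Propositional.Properties using (∈-lookup; ∈-map⁻; ∈-cartesianProductWith⁻; ∈-++⁻)
open import Data.List.Properties using (map-tabulate; length-tabulate; length-drop; length-++; length-map; map-++; map-∘; tabulate-cong; ++-assoc)
open import Data.List.Relation.Binary.Permutation.Propositional using (_↭_; prep; ↭-trans; ↭⇒↭ₛ)
import Data.List.Relation.Binary.Permutation.Propositional.Properties as ↭
import Data.List.Relation.Binary.Permutation.Setoid.Properties as ↭ₛ
import Data.List.Relation.Unary.All as All
open import Data.List.Relation.Unary.AllPairs using ([]; _∷_)
open import Data.List.Relation.Unary.Unique.Propositional using (Unique)
import Data.List.Relation.Unary.Unique.Propositional.Properties as Unique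
open import Data.Nat using (_+_; _*_; _^_)
open import Data.Nat.ListAction using (sum)
open import Data.Nat.ListAction.Properties using (sum-++; sum-↭)
open import Data.Vec.Properties using ([]=⇒lookup)
open import Defs
open import Function using (id)
open import Relation.Binary.PropositionalEquality using (_≢_)
open import Relation.Nullary using (Dec; does; contradiction)
open import Relation.Nullary.Decidable using (dec-true; dec-false)

-- Incidence structures and their graphs

indicator : Bool → ℕ
indicator b = if b then 1 else 0

sum-tabulate-const : ∀ {n} c (f : Fin n → ℕ) → (∀ i → f i ≡ c) → sum (tabulate f) ≡ n * c
sum-tabulate-const {zero}  c f f≡c = ≡.refl
sum-tabulate-const {suc n} c f f≡c = cong₂ _+_ (f≡c zero) (sum-tabulate-const c (f ∘ suc) (f≡c ∘ suc))

sum-tabulate-0 : ∀ {n} (f : Fin n → ℕ) → (∀ i → f i ≡ 0) → sum (tabulate f) ≡ 0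
sum-tabulate-0 {n} f f≡0 = ≡.trans (sum-tabulate-const 0 f f≡0) (ℕ.*-zeroʳ n)

sum-tabulate-1 : ∀ {n} (f : Fin n → ℕ) → (∀ i → f i ≡ 1) → sum (tabulate f) ≡ n
sum-tabulate-1 {n} f f≡1 = ≡.trans (sum-tabulate-const 1 f f≡1) (ℕ.*-identityʳ n)

sum-tabulate-single : ∀ {n c} (f : Fin n → ℕ) i → f i ≡ c → (∀ j → j ≢ i → f j ≡ 0) → sum (tabulate f) ≡ c
sum-tabulate-single {c = c} f zero    fi f≡0 = ≡.trans
  (cong₂ _+_ fi (sum-tabulate-0 (f ∘ suc) λ j → f≡0 (suc j) λ ())) (ℕ.+-identityʳ c)
sum-tabulate-single f (suc i) fi f≡0 = cong₂ _+_ (f≡0 zero λ ())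
  (sum-tabulate-single (f ∘ suc) i fi λ j j≢i → f≡0 (suc j) (j≢i ∘ Fin.suc-injective))

sum-cartesianProductWith : ∀ {A B C : Set} (f : C → ℕ) (g : A → B → C) xs ys →
  sum (map f (cartesianProductWith g xs ys)) ≡ sum (map (λ x → sum (map (λ y → f (g x y)) ys)) xs)
sum-cartesianProductWith f g []       ys = ≡.refl
sum-cartesianProductWith f g (x ∷ xs) ys = begin
  sum (map f (map (g x) ys ++ rest))             ≡⟨ cong sum (map-++ f (map (g x) ys) rest) ⟩
  sum (map f (map (g x) ys) ++ map f rest)       ≡⟨ sum-++ (map f (map (g x) ys)) _ ⟩
  sum (map f (map (g x) ys)) + sum (map f rest)  ≡⟨ cong₂ _+_ (cong sum (≡.sym (map-∘ ys))) (sum-cartesianProductWith f g xs ys) ⟩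
  _                                              ∎
  where
  open ≡.≡-Reasoning
  rest = cartesianProductWith g xs ys

length-cartesianProductWith : ∀ {A B C : Set} (g : A → B → C) xs ys →
  length (cartesianProductWith g xs ys) ≡ length xs * length ys
length-cartesianProductWith g []       ys = ≡.refl
length-cartesianProductWith g (x ∷ xs) ys = ≡.trans (length-++ (map (g x) ys))
  (cong₂ _+_ (length-map (g x) ys) (length-cartesianProductWith g xs ys))

lookup-injective : ∀ {A : Set} {xs : List A} → Unique xs → ∀ {i j} → List.lookup xs i ≡ List.lookup xs j → i ≡ j
lookup-injective (x∉ ∷ u) {zero}  {zero}  eq = ≡.refl
lookup-injective (x∉ ∷ u) {zero}  {suc j} eq = contradiction eq (All.lookup x∉ (∈-lookup j))
lookup-injective (x∉ ∷ u) {suc i} {zero}  eq = contradiction (≡.sym eq) (All.lookup x∉ (∈-lookup i))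
lookup-injective (x∉ ∷ u) {suc i} {suc j} eq = cong suc (lookup-injective u eq)

module Incidence {A B : Set} {_I_ : A → B → Set} (_I?_ : ∀ x y → Dec (x I y)) where

  inc : A → B → ℕ
  inc x y = indicator (does (x I? y))

  row : A → List B → ℕ
  row x ys = sum (map (inc x) ys)

  col : B → List A → ℕ
  col y xs = sum (map (λ x → inc x y) xs)

  incidences : List A → List B → ℕ
  incidences xs ys = sum (map (λ x → row x ys) xs)

  incidences-∷ʳ : ∀ xs y ys → incidences xs (y ∷ ys) ≡ col y xs + incidences xs ys
  incidences-∷ʳ []       y ys = ≡.refl
  incidences-∷ʳ (x ∷ xs) y ys = ≡.trans (cong (λ t → row x (y ∷ ys) + t) (incidences-∷ʳ xs y ys))
    (assoc (inc x y) (row x ys) (col y xs) (incidences xs ys))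
    where
    assoc : ∀ a b c d → (a + b) + (c + d) ≡ (a + c) + (b + d)
    assoc = solve-∀

  -- The incidence of x with y occurs both in the row and in the column; adding it on the left
  -- instead of subtracting it on the right avoids truncated subtraction.
  incidences-delete : ∀ x y xs ys → incidences (x ∷ xs) (y ∷ ys) + inc x y ≡
                      row x (y ∷ ys) + col y (x ∷ xs) + incidences xs ys
  incidences-delete x y xs ys = ≡.trans (cong (λ t → row x (y ∷ ys) + t + inc x y) (incidences-∷ʳ xs y ys))
    (assoc (row x (y ∷ ys)) (col y xs) (incidences xs ys) (inc x y))
    where
    assoc : ∀ a b c d → a + (b + c) + d ≡ a + (d + b) + c
    assoc = solve-∀

  incidences-regular : ∀ {d} xs ys → (∀ x → row x ys ≡ d) → incidences xs ys ≡ length xs * d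
  incidences-regular []       ys reg = ≡.refl
  incidences-regular (x ∷ xs) ys reg = cong₂ _+_ (reg x) (incidences-regular xs ys reg)

  graph : (xs : List A) (ys : List B) → BipGraph (length xs) (length ys)
  graph xs ys = Vec.tabulate λ i → Vec.tabulate λ j → does (List.lookup xs i I? List.lookup ys j)

  ∈-graph : ∀ xs ys {i j} → j ∈ Vec.lookup (graph xs ys) i → List.lookup xs i I List.lookup ys j
  ∈-graph xs ys {i} {j} j∈ with List.lookup xs i I? List.lookup ys j | entry
    where
    entry : does (List.lookup xs i I? List.lookup ys j) ≡ true
    entry = ≡.trans (≡.sym (lookup∘tabulate _ j))
      (≡.trans (cong (λ r → Vec.lookup r j) (≡.sym (lookup∘tabulate _ i))) ([]=⇒lookup j∈))
  ... | yes xIy | _ = xIy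

  edges-graph : ∀ xs ys → edges (graph xs ys) ≡ incidences xs ys
  edges-graph []       ys = ≡.refl
  edges-graph (x ∷ xs) ys = cong₂ _+_ (card ys) (edges-graph xs ys)
    where
    card : ∀ ys → ∣ Vec.tabulate (λ j → does (x I? List.lookup ys j)) ∣ ≡ row x ys
    card []       = ≡.refl
    card (y ∷ ys) with does (x I? y)
    ... | true  = cong suc (card ys)
    ... | false = card ys

  -- The condition of a partial linear space, which is C₄-freeness read as a property of the
  -- incidence relation.
  LinearSpace : Set
  LinearSpace = ∀ {x x′ y y′} → x I y → x I y′ → x′ I y → x′ I y′ → x ≡ x′ ⊎ y ≡ y′

  graph-C₄-free : LinearSpace → ∀ {xs ys} → Unique xs → Unique ys → C₄-Free (graph xs ys)
  graph-C₄-free linear {xs} {ys} uxs uys c with K₂₂⇒rectangle _ c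
  ... | i , i′ , j , j′ , i≢i′ , j≢j′ , ij , ij′ , i′j , i′j′
    with linear (∈-graph xs ys ij) (∈-graph xs ys ij′) (∈-graph xs ys i′j) (∈-graph xs ys i′j′)
  ... | inj₁ eq = i≢i′ (lookup-injective uxs eq)
  ... | inj₂ eq = j≢j′ (lookup-injective uys eq)

  realise : LinearSpace → ∀ {xs ys} → Unique xs → Unique ys → ∀ {m n} → length xs ≡ m → length ys ≡ n →
            ∃ λ (G : BipGraph m n) → C₄-Free G × edges G ≡ incidences xs ys
  realise linear {xs} {ys} uxs uys ≡.refl ≡.refl =
    graph xs ys , graph-C₄-free linear uxs uys , edges-graph xs ys

-- The projective plane in coordinates

module Plane {l} (co : Coordinates l) where
  open Coordinates co

  k : ℕ
  k = suc (suc l)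

  F : Set
  F = Fin k

  -- Used for both points and lines.  As points, slope s is the common point of the lines of slope s and
  -- ∞ that of the vertical lines; as lines, aff m b is y = m x - b, slope c is x = c, and ∞ is the line
  -- at infinity.  These conventions make incidence symmetric.
  data Node : Set where
    ∞     : Node
    slope : F → Node
    aff   : F → F → Node

  infix 4 _I_
  data _I_ : Node → Node → Set where
    ∞I∞         : ∞ I ∞
    ∞Islope     : ∀ {s} → ∞ I slope s
    slopeI∞     : ∀ {c} → slope c I ∞
    slopeIaff   : ∀ {c y} → slope c I aff c y
    affIslope   : ∀ {m b} → aff m b I slope m
    affIaff     : ∀ {m b x y : F} → solve m x b ≡ y → aff m b I aff x y

  _I?_ : ∀ p q → Dec (p I q)
  ∞       I? ∞       = yes ∞I∞
  ∞       I? slope s = yes ∞Islope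
  ∞       I? aff x y = no λ ()
  slope c I? ∞       = yes slopeI∞
  slope c I? slope s = no λ ()
  slope c I? aff x y = map′ (λ { ≡.refl → slopeIaff }) (λ { slopeIaff → ≡.refl }) (c Fin.≟ x)
  aff m b I? ∞       = no λ ()
  aff m b I? slope s = map′ (λ { ≡.refl → affIslope }) (λ { affIslope → ≡.refl }) (m Fin.≟ s)
  aff m b I? aff x y = map′ affIaff (λ { (affIaff eq) → eq }) (solve m x b Fin.≟ y)

  open Incidence _I?_

  solve-injective : ∀ {m x b b′} → solve m x b ≡ solve m x b′ → b ≡ b′
  solve-injective {m} {x} {b} {b′} eq =
    ≡.trans (≡.sym (solve-involutive m x b)) (≡.trans (cong (solve m x) eq) (solve-involutive m x b′))

  -- Four affine nodes are the business of `solve-two`. As soon as a node at infinity takes part, it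
  -- forces the coordinates to agree, at most with the help of `solve-injective`.
  linear : LinearSpace
  linear ∞I∞ ∞I∞ _ _ = inj₂ ≡.refl
  linear ∞I∞ ∞Islope ∞I∞ ∞Islope = inj₁ ≡.refl
  linear ∞Islope ∞I∞ ∞Islope ∞I∞ = inj₁ ≡.refl
  linear ∞Islope ∞Islope ∞Islope ∞Islope = inj₁ ≡.refl
  linear ∞Islope ∞Islope affIslope affIslope = inj₂ ≡.refl
  linear slopeI∞ slopeI∞ _ _ = inj₂ ≡.refl
  linear slopeI∞ slopeIaff slopeI∞ slopeIaff = inj₁ ≡.refl
  linear slopeIaff slopeI∞ slopeIaff slopeI∞ = inj₁ ≡.refl
  linear slopeIaff slopeIaff slopeIaff slopeIaff = inj₁ ≡.refl
  linear slopeIaff slopeIaff (affIaff ≡.refl) (affIaff ≡.refl) = inj₂ ≡.refl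
  linear affIslope affIslope _ _ = inj₂ ≡.refl
  linear affIslope (affIaff ≡.refl) affIslope (affIaff q) = inj₁ (cong (aff _) (≡.sym (solve-injective q)))
  linear (affIaff ≡.refl) affIslope (affIaff q) affIslope = inj₁ (cong (aff _) (≡.sym (solve-injective q)))
  linear (affIaff ≡.refl) (affIaff ≡.refl) slopeIaff slopeIaff = inj₂ ≡.refl
  linear (affIaff ≡.refl) (affIaff ≡.refl) (affIaff q) (affIaff q′) with solve-two q q′
  ... | inj₁ ≡.refl = inj₁ (cong (aff _) (≡.sym (solve-injective q)))
  ... | inj₂ ≡.refl = inj₂ ≡.refl

  -- For affine nodes, y = m x - b is the same as b = x m - y; this is what the minus sign in
  -- `solve` is for. Symmetry lets one degree count serve points and lines alike.
  I-sym : ∀ {p q} → p I q → q I p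
  I-sym ∞I∞ = ∞I∞
  I-sym ∞Islope = slopeI∞
  I-sym slopeI∞ = ∞Islope
  I-sym slopeIaff = affIslope
  I-sym affIslope = slopeIaff
  I-sym (affIaff {m} {b} {x} ≡.refl) = affIaff (≡.trans (solve-comm x m _) (solve-involutive m x b))

  inc-yes : ∀ {p q} → p I q → inc p q ≡ 1
  inc-yes {p} {q} pIq = cong indicator (dec-true (p I? q) pIq)

  inc-no : ∀ {p q} → ¬ p I q → inc p q ≡ 0
  inc-no {p} {q} ¬pIq = cong indicator (dec-false (p I? q) ¬pIq)

  inc-sym : ∀ p q → inc p q ≡ inc q p
  inc-sym p q with q I? p
  ... | yes qIp = inc-yes (I-sym qIp)
  ... | no ¬qIp = inc-no (¬qIp ∘ I-sym)

  slopes affs nodes : List Node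
  slopes = map slope (allFin k)
  affs   = cartesianProductWith aff (allFin k) (allFin k)
  nodes  = ∞ ∷ slopes ++ affs

  length-nodes : length nodes ≡ k ^ 2 + k + 1
  length-nodes = begin
    suc (length (slopes ++ affs))             ≡⟨ cong suc (length-++ slopes) ⟩
    suc (length slopes + length affs)         ≡⟨ cong suc (cong₂ _+_ (length-map slope (allFin k)) (length-cartesianProductWith aff (allFin k) (allFin k))) ⟩
    suc (length (allFin k) + length (allFin k) * length (allFin k)) ≡⟨ cong (λ n → suc (n + n * n)) (length-tabulate {n = k} id) ⟩
    suc (k + k * k)                           ≡⟨ rearrange k ⟩
    k ^ 2 + k + 1                             ∎
    where
    open ≡.≡-Reasoning
    rearrange : ∀ k → suc (k + k * k) ≡ k * (k * 1) + k + 1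
    rearrange = solve-∀

  onColumn : Node → F → ℕ
  onColumn p x = sum (tabulate (λ y → inc p (aff x y)))

  onSlopes onAffs : Node → ℕ
  onSlopes p = sum (tabulate (λ s → inc p (slope s)))
  onAffs   p = sum (tabulate (λ x → onColumn p x))

  row-nodes : ∀ p → row p nodes ≡ inc p ∞ + (onSlopes p + onAffs p)
  row-nodes p = cong (λ t → inc p ∞ + t) (begin
    sum (map (inc p) (slopes ++ affs))                   ≡⟨ cong sum (map-++ (inc p) slopes affs) ⟩
    sum (map (inc p) slopes ++ map (inc p) affs)         ≡⟨ sum-++ (map (inc p) slopes) _ ⟩
    row p slopes + row p affs                            ≡⟨ cong₂ _+_ slopes≡ affs≡ ⟩
    onSlopes p + onAffs p                                ∎)
    where
    open ≡.≡-Reasoning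
    slopes≡ : row p slopes ≡ onSlopes p
    slopes≡ = cong sum (≡.trans (≡.sym (map-∘ {g = inc p} {f = slope} (allFin k))) (map-tabulate id (λ s → inc p (slope s))))
    affs≡ : row p affs ≡ onAffs p
    affs≡ = ≡.trans (sum-cartesianProductWith (inc p) aff (allFin k) (allFin k))
      (cong sum (≡.trans (map-tabulate id (λ x → sum (map (λ y → inc p (aff x y)) (allFin k))))
        (tabulate-cong λ x → cong sum (map-tabulate id (λ y → inc p (aff x y))))))

  -- The k + 1 nodes are: for ∞, itself and all slopes; for `slope c`, the node ∞ and every
  -- `aff c y`; for `aff m b`, the node `slope m` and one affine node in each column x.
  regular : ∀ p → row p nodes ≡ suc k
  regular ∞ = ≡.trans (row-nodes ∞) (cong suc (≡.trans (cong₂ _+_ onSlopes≡ onAffs≡) (ℕ.+-identityʳ k)))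
    where
    onSlopes≡ : onSlopes ∞ ≡ k
    onSlopes≡ = sum-tabulate-1 (λ s → inc ∞ (slope s)) λ s → ≡.refl
    onAffs≡ : onAffs ∞ ≡ 0
    onAffs≡ = sum-tabulate-0 (onColumn ∞) λ x → sum-tabulate-0 (λ y → inc ∞ (aff x y)) λ y → ≡.refl
  regular (slope c) = ≡.trans (row-nodes (slope c)) (cong suc (cong₂ _+_ onSlopes≡ onAffs≡))
    where
    onSlopes≡ : onSlopes (slope c) ≡ 0
    onSlopes≡ = sum-tabulate-0 (λ s → inc (slope c) (slope s)) λ s → ≡.refl
    onAffs≡ : onAffs (slope c) ≡ k
    onAffs≡ = sum-tabulate-single (onColumn (slope c)) c
      (sum-tabulate-1 (λ y → inc (slope c) (aff c y)) λ y → inc-yes (slopeIaff {c} {y}))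
      λ x x≢c → sum-tabulate-0 (λ y → inc (slope c) (aff x y)) λ y → inc-no {slope c} {aff x y} λ { slopeIaff → x≢c ≡.refl }
  regular (aff m b) = ≡.trans (row-nodes (aff m b)) (cong₂ _+_ onSlopes≡ onAffs≡)
    where
    onSlopes≡ : onSlopes (aff m b) ≡ 1
    onSlopes≡ = sum-tabulate-single (λ s → inc (aff m b) (slope s)) m (inc-yes (affIslope {m} {b}))
      λ s s≢m → inc-no {aff m b} {slope s} λ { affIslope → s≢m ≡.refl }
    onAffs≡ : onAffs (aff m b) ≡ k
    onAffs≡ = sum-tabulate-1 (onColumn (aff m b)) λ x →
      sum-tabulate-single (λ y → inc (aff m b) (aff x y)) (solve m x b) (inc-yes (affIaff {m} {b} {x} ≡.refl))
        λ y y≢ → inc-no {aff m b} {aff x y} λ { (affIaff eq) → y≢ (≡.sym eq) }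

  col≡row : ∀ p qs → col p qs ≡ row p qs
  col≡row p []       = ≡.refl
  col≡row p (q ∷ qs) = cong₂ _+_ (inc-sym q p) (col≡row p qs)

  row-↭ : ∀ p {qs qs′} → qs ↭ qs′ → row p qs ≡ row p qs′
  row-↭ p perm = sum-↭ (↭.map⁺ (inc p) perm)

  unique-nodes : Unique nodes
  unique-nodes = All.tabulate (λ q∈ → ∞∉ (∈-++⁻ slopes q∈)) ∷
    Unique.++⁺ (Unique.map⁺ (λ { ≡.refl → ≡.refl }) (Unique.allFin⁺ k))
      (Unique.cartesianProductWith⁺ aff (λ { ≡.refl → ≡.refl , ≡.refl }) (Unique.allFin⁺ k) (Unique.allFin⁺ k))
      (λ { (s∈ , a∈) → disjoint s∈ a∈ })
    where
    disjoint : ∀ {q} → q ∈ₗ slopes → q ∈ₗ affs → ⊥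
    disjoint s∈ a∈ with ∈-map⁻ slope s∈ | ∈-cartesianProductWith⁻ aff (allFin k) (allFin k) a∈
    ... | _ , _ , ≡.refl | _ , _ , _ , _ , ()
    ∞∉ : ∀ {q} → q ∈ₗ slopes ⊎ q ∈ₗ affs → ∞ ≢ q
    ∞∉ (inj₁ s∈) ≡.refl with ∈-map⁻ slope s∈
    ... | _ , _ , ()
    ∞∉ (inj₂ a∈) ≡.refl with ∈-cartesianProductWith⁻ aff (allFin k) (allFin k) a∈
    ... | _ , _ , _ , _ , ()

  -- Deletion of incident points and lines

  private
    higherSlopes aff₀ aff₁ affs′ : List Node
    higherSlopes = map slope (tabulate (λ i → suc (suc i)))
    aff₀ = map (aff zero) (tabulate suc)
    aff₁ = map (aff (suc zero)) (tabulate suc)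
    affs′ = aff₁ ++ cartesianProductWith aff (tabulate (λ i → suc (suc i))) (allFin k)

  -- The first h entries are those to be deleted: the triangle with vertices ∞, slope 0 and the origin,
  -- then another point m at infinity and the line y = m x; suc zero need not be the unit of the field.
  lines points : List Node
  lines  = ∞ ∷ slope zero ∷ aff zero zero ∷ aff (suc zero) zero ∷ slope (suc zero) ∷ higherSlopes ++ aff₀ ++ affs′
  points = ∞ ∷ slope zero ∷ aff zero zero ∷ slope (suc zero) ∷ higherSlopes ++ aff₀ ++ aff (suc zero) zero ∷ affs′

  -- `nodes` unfolds to the same pieces with `aff zero zero` in front of `aff₀` and
  -- `aff (suc zero) zero` in front of `affs′`, so one shift is enough for each node brought
  -- forward.
  nodes↭points : nodes ↭ points
  nodes↭points = prep ∞ (prep (slope zero) (↭.shift (aff zero zero) (slope (suc zero) ∷ higherSlopes) _))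

  nodes↭lines : nodes ↭ lines
  nodes↭lines = ↭-trans nodes↭points (prep ∞ (prep (slope zero) (prep (aff zero zero)
    (≡.subst₂ _↭_ (cong (slope (suc zero) ∷_) (++-assoc higherSlopes aff₀ (aff (suc zero) zero ∷ affs′)))
      (cong (λ qs → aff (suc zero) zero ∷ slope (suc zero) ∷ qs) (++-assoc higherSlopes aff₀ affs′))
      (↭.shift (aff (suc zero) zero) (slope (suc zero) ∷ higherSlopes ++ aff₀) affs′)))))

  unique-lines : Unique lines
  unique-lines = ↭ₛ.Unique-resp-↭ (≡.setoid Node) (↭⇒↭ₛ nodes↭lines) unique-nodes

  unique-points : Unique points
  unique-points = ↭ₛ.Unique-resp-↭ (≡.setoid Node) (↭⇒↭ₛ nodes↭points) unique-nodes

  row-points : ∀ p → row p points ≡ suc k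
  row-points p = ≡.trans (≡.sym (row-↭ p nodes↭points)) (regular p)

  col-lines : ∀ p → col p lines ≡ suc k
  col-lines p = ≡.trans (col≡row p lines) (≡.trans (≡.sym (row-↭ p nodes↭lines)) (regular p))

  length-lines : length lines ≡ k ^ 2 + k + 1
  length-lines = ≡.trans (≡.sym (↭.↭-length nodes↭lines)) length-nodes

  length-points : length points ≡ k ^ 2 + k + 1
  length-points = ≡.trans (≡.sym (↭.↭-length nodes↭points)) length-nodes

  remaining : ℕ → ℕ
  remaining h = incidences (drop h lines) (drop h points)

  remaining-0 : remaining 0 ≡ (k ^ 2 + k + 1) * suc k
  remaining-0 = ≡.trans (incidences-regular lines points row-points) (cong (_* suc k) length-lines)

  remaining-1 : remaining 0 + 1 ≡ suc k + suc k + remaining 1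
  remaining-1 = ≡.trans (incidences-delete ∞ ∞ (drop 1 lines) (drop 1 points))
    (cong₂ (λ r c → r + c + remaining 1) (row-points ∞) (col-lines ∞))

  -- From here on, the line and the point removed are each incident with exactly one node already
  -- deleted, so both have k incidences left; `suc-injective` strikes out the lost one. Only the
  -- incidence between the two varies: here the line x = 0 misses the point `slope zero`, whence the
  -- 0.
  remaining-2 : remaining 1 + 0 ≡ k + k + remaining 2
  remaining-2 = ≡.trans (incidences-delete (slope zero) (slope zero) (drop 2 lines) (drop 2 points))
    (cong₂ (λ r c → r + c + remaining 2)
      (ℕ.suc-injective (row-points (slope zero))) (ℕ.suc-injective (col-lines (slope zero))))

  inc-origin : ∀ m → inc (aff m zero) (aff zero zero) ≡ 1
  inc-origin m = inc-yes (affIaff (solve-zero m))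

  remaining-3 : remaining 2 + 1 ≡ k + k + remaining 3
  remaining-3 = ≡.trans (cong (λ t → remaining 2 + t) (≡.sym (inc-origin zero)))
    (≡.trans (incidences-delete (aff zero zero) (aff zero zero) (drop 3 lines) (drop 3 points))
      (cong₂ (λ r c → r + c + remaining 3)
        (ℕ.suc-injective (row-points (aff zero zero))) (ℕ.suc-injective (col-lines (aff zero zero)))))

  remaining-4 : remaining 3 + 1 ≡ k + k + remaining 4
  remaining-4 = ≡.trans (incidences-delete (aff (suc zero) zero) (slope (suc zero)) (drop 4 lines) (drop 4 points))
    (cong₂ (λ r c → r + c + remaining 4)
      -- The lost incidence is with the origin. It depends on a value of `solve` and does not
      -- compute to 1, so `inc-origin` supplies it before it is struck out.
      (ℕ.suc-injective (≡.trans (cong (_+ row (aff (suc zero) zero) (drop 3 points)) (≡.sym (inc-origin (suc zero))))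
        (row-points (aff (suc zero) zero))))
      (ℕ.suc-injective (col-lines (slope (suc zero)))))

  realise-remaining : ∀ h → let n = k ^ 2 + k + 1 ∸ h in
                      ∃ λ (G : BipGraph n n) → C₄-Free G × edges G ≡ remaining h
  realise-remaining h = realise linear (Unique.drop⁺ h unique-lines) (Unique.drop⁺ h unique-points)
    (≡.trans (length-drop h lines) (cong (_∸ h) length-lines))
    (≡.trans (length-drop h points) (cong (_∸ h) length-points))

-- From the edge counts to the stated polynomials

pos-^ : ∀ m n → + (m ^ n) ≡ (+ m) ℤ.^ n
pos-^ m zero    = ≡.refl
pos-^ m (suc n) = ≡.trans (ℤ.pos-* m (m ^ n)) (cong (λ y → + m ℤ.* y) (pos-^ m n))

-- With the counts abstracted to e, only integer polynomial identities in k remain. After the first,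
-- the cubic part c is carried along as an indeterminate.
deletion⇒bound : ∀ k (e : ℕ → ℕ) → e 0 ≡ (k ^ 2 + k + 1) * suc k → e 0 + 1 ≡ suc k + suc k + e 1 →
                 e 1 + 0 ≡ k + k + e 2 → e 2 + 1 ≡ k + k + e 3 → e 3 + 1 ≡ k + k + e 4 →
                 ∀ h → + e (toℕ h) ≡ bound (+ k) h
deletion⇒bound k e e₀ e₁ e₂ e₃ e₄ = λ { 0F → b₀ ; 1F → b₁ ; 2F → b₂ ; 3F → b₃ ; 4F → b₄ }
  where
  κ = + k

  solveFor : ∀ a c d {b} → a + c ≡ d + b → + b ≡ + a ℤ.+ + c ℤ.- + d
  solveFor a c d {b} eq = ≡.trans (cancel (+ d) (+ b)) (cong (λ y → + y ℤ.- + d) (≡.sym eq))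
    where
    cancel : ∀ d b → b ≡ d ℤ.+ b ℤ.- d
    cancel = ℤSolver.solve-∀

  b₀ : + e 0 ≡ bound κ 0F
  b₀ = ≡.trans (cong +_ e₀) (≡.trans (ℤ.pos-* (k ^ 2 + k + 1) (suc k))
    (≡.trans (cong (λ y → (y ℤ.+ κ ℤ.+ + 1) ℤ.* (+ 1 ℤ.+ κ)) (pos-^ k 2)) (expand κ)))
    where
    expand : ∀ x → (x ℤ.* (x ℤ.* + 1) ℤ.+ x ℤ.+ + 1) ℤ.* (+ 1 ℤ.+ x) ≡
      x ℤ.* (x ℤ.* (x ℤ.* + 1)) ℤ.+ + 2 ℤ.* (x ℤ.* (x ℤ.* + 1)) ℤ.+ + 2 ℤ.* x ℤ.+ + 1
    expand = ℤSolver.solve-∀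

  b₁ : + e 1 ≡ bound κ 1F
  b₁ = ≡.trans (solveFor (e 0) 1 (suc k + suc k) e₁) (≡.trans (cong (λ y → y ℤ.+ + 1 ℤ.- (+ suc k ℤ.+ + suc k)) b₀) (simplify (κ ℤ.^ 3 ℤ.+ + 2 ℤ.* κ ℤ.^ 2) κ))
    where
    simplify : ∀ c x → c ℤ.+ + 2 ℤ.* x ℤ.+ + 1 ℤ.+ + 1 ℤ.- ((+ 1 ℤ.+ x) ℤ.+ (+ 1 ℤ.+ x)) ≡ c
    simplify = ℤSolver.solve-∀

  b₂ : + e 2 ≡ bound κ 2F
  b₂ = ≡.trans (solveFor (e 1) 0 (k + k) e₂) (≡.trans (cong (λ y → y ℤ.+ + 0 ℤ.- (κ ℤ.+ κ)) b₁) (simplify (κ ℤ.^ 3 ℤ.+ + 2 ℤ.* κ ℤ.^ 2) κ))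
    where
    simplify : ∀ c x → c ℤ.+ + 0 ℤ.- (x ℤ.+ x) ≡ c ℤ.- + 2 ℤ.* x
    simplify = ℤSolver.solve-∀

  b₃ : + e 3 ≡ bound κ 3F
  b₃ = ≡.trans (solveFor (e 2) 1 (k + k) e₃) (≡.trans (cong (λ y → y ℤ.+ + 1 ℤ.- (κ ℤ.+ κ)) b₂) (simplify (κ ℤ.^ 3 ℤ.+ + 2 ℤ.* κ ℤ.^ 2) κ))
    where
    simplify : ∀ c x → c ℤ.- + 2 ℤ.* x ℤ.+ + 1 ℤ.- (x ℤ.+ x) ≡ c ℤ.- + 4 ℤ.* x ℤ.+ + 1
    simplify = ℤSolver.solve-∀

  b₄ : + e 4 ≡ bound κ 4F
  b₄ = ≡.trans (solveFor (e 3) 1 (k + k) e₄) (≡.trans (cong (λ y → y ℤ.+ + 1 ℤ.- (κ ℤ.+ κ)) b₃) (simplify (κ ℤ.^ 3 ℤ.+ + 2 ℤ.* κ ℤ.^ 2) κ))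
    where
    simplify : ∀ c x → c ℤ.- + 4 ℤ.* x ℤ.+ + 1 ℤ.+ + 1 ℤ.- (x ℤ.+ x) ≡ c ℤ.- + 6 ℤ.* x ℤ.+ + 2
    simplify = ℤSolver.solve-∀

coordinates⇒bound : ∀ {l} → Coordinates l → (h : Fin 5) →
  let k = suc (suc l)
      n = k ^ 2 + k + 1 ∸ toℕ h in
  (∃ λ (G : BipGraph n n) → C₄-Free G × + edges G ≡ bound (+ k) h)
  × + z n ≥ᶻ bound (+ k) h
coordinates⇒bound {l} co h =
  let G , free , edges≡ = realise-remaining (toℕ h)
      +edges≡ = ≡.trans (≡.cong +_ edges≡)
        (deletion⇒bound (suc (suc l)) remaining remaining-0 remaining-1 remaining-2 remaining-3 remaining-4 h)
  in (G , free , +edges≡) , ℤ.≤-trans (ℤ.≤-reflexive (≡.sym +edges≡)) (ℤ.+≤+ (z-upper G free))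
  where open Plane co

theorem2 : (k : ℕ) → IsPrimePower k → (h : Fin 5) →
    let n = k ^ 2 + k + 1 ∸ toℕ h in
    (∃ λ (G : BipGraph n n) → C₄-Free G × + edges G ≡ bound (+ k) h)
    × + z n ≥ᶻ bound (+ k) h
theorem2 k (p , suc b , pr , _ , k≡) h = go k k≡ 2≤k
  where
  2≤p = ℕ.nonTrivial⇒n>1 p {{prime⇒nonTrivial pr}}
  2≤k : 2 ≤ k
  2≤k = ≡.subst (2 ≤_) (≡.sym k≡) (ℕ.≤-trans 2≤p (ℕ.m≤m*n p (p ^ b) {{ℕ.m^n≢0 p b {{prime⇒nonZero pr}}}}))
  go : ∀ k → k ≡ p ^ suc b → 2 ≤ k → let n = k ^ 2 + k + 1 ∸ toℕ h in
       (∃ λ (G : BipGraph n n) → C₄-Free G × + edges G ≡ bound (+ k) h) × + z n ≥ᶻ bound (+ k) h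
  go (suc (suc l)) eq _ = coordinates⇒bound (primePower⇒coordinates p l pr b (≡.sym eq)) h
  go (suc zero) eq (s≤s ())
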